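{- For any integers $k \ge 2$ and $d \ge 0$, there exists a graph $G$ with $ch_{\mathcal{S}}(G) \le k$ and $ch_{\mathcal{D}_d}(G) = k(k+1)$. In particular, for any real constant $p$, there exists a graph $G$ with $$ch(G) \ge p \cdot ch_{\mathcal{S}}(G) \ge p \cdot ch_{\mathcal{F}}(G) \ge p \cdot ch_{\mathcal{M}_2}(G).$$
   Context: Graphs are finite, simple, undirected, and have at least one vertex. Let $\mathcal{G}$ be a hereditary family of graphs (closed under taking induced subgraphs). A $\mathcal{G}$-colouring of a graph $G$ is a colouring $\phi$ of the vertices of $G$ (not required to be proper) such that each (nonempty) colour class induces a graph in $\mathcal{G}$. For a positive integer $n$, an $n$-list assignment of $G$ is a map $L$ that assigns to each vertex $v$ a set $L(v)$ of exactly $n$ colours. A $\mathcal{G}$-$L$-colouring of $G$ is a $\mathcal{G}$-colouring $\phi$ of $G$ with $\phi(v) \in L(v)$ for every vertex $v$. The graph $G$ is $\mathcal{G}$-$n$-choosable if for every $n$-list assignment $L$ of $G$ there exists a $\mathcal{G}$-$L$-colouring of $G$. The $\mathcal{G}$-choice number is $$ch_{\mathcal{G}}(G) = \min\{n : G \text{ is } \mathcal{G}\text{ - }n\text{ -choosable}\}.$$ The families used are: - $\mathcal{S}$, the family of star forests, i.e. graphs each of whose connected components is a star $K_{1,r}$ with $r \ge 0$ (a single vertex counts as a star); - $\mathcal{F}$, the family of forests; - $\mathcal{D}_d$, the family of graphs of maximum degree at most $d$; - $\mathcal{M}_k$, the family of graphs of maximum average degree at most $k$, where the maximum average degree of a graph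 is the maximum of $2|E(H)|/|V(H)|$ over its nonempty subgraphs $H$. The number $ch(G)$ is the usual choice number (list chromatic number) of $G$, i.e. $ch(G) = ch_{\mathcal{D}_0}(G)$. -}

module Defs where

open import Data.Bool.Base using (Bool; true; false; T)
open import Data.Bool.Properties using (T?)
open import Data.Fin.Base using (Fin; zero; suc)
import Data.Fin.Properties as Fin
open import Data.Fin.Subset using (Subset; _∈_; ∣_∣)
open import Data.Integer.Base using (+_)
open import Data.List.Base as List using (List; _∷_; _∷ʳ_; allFin; cartesianProduct; filter; length)
open import Data.List.Extrema.Nat using (max)
open import Data.List.Relation.Unary.Linked using (Linked)
open import Data.List.Relation.Unary.Unique.Propositional using () renaming (Unique to UniqueList)
open import Data.Nat.Base as ℕ using (ℕ; zero; suc; _≤_; _<_)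
import Data.Nat.Properties as ℕ
open import Data.Product.Base using (∃; _×_; _,_)
open import Data.Rational.Base as ℚ using (ℚ; 0ℚ; 1ℚ; _/_)
import Data.Rational.Properties as ℚ
open import Data.Vec.Base using (Vec; _∷_; tabulate)
import Data.Vec.Membership.Propositional as Vec
open import Data.Vec.Relation.Unary.Unique.Propositional using (Unique)
open import Function.Bundles using (_↔_; _⇔_; Inverse)
open import Function.Definitions using (Injective)
open import Level using (0ℓ)
open import Relation.Binary.Construct.Closure.ReflexiveTransitive using (Star)
open import Relation.Binary.Core using (Rel)
open import Relation.Binary.PropositionalEquality using (_≡_; refl; cong; sym; trans)
open import Relation.Nullary.Decidable.Core using (does; _×-dec_)
open import Relation.Nullary.Negation.Core using (¬_)

------------------------------------------------------------------------
-- Graphs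

record Graph : Set where
  infix 4 _~_
  field
    order       : ℕ
    .{{order≢0}} : ℕ.NonZero order
    adj         : Fin order → Fin order → Bool
    adj-sym     : ∀ u v → adj u v ≡ adj v u
    adj-irrefl  : ∀ v → adj v v ≡ false

  Vertex : Set
  Vertex = Fin order

  _~_ : Rel Vertex 0ℓ
  u ~ v = T (adj u v)

open Graph using (order; Vertex)

-- The elements of U in increasing order.
enumerate : ∀ {n} (U : Subset n) → Fin ∣ U ∣ → Fin n
enumerate (true  ∷ U) zero    = zero
enumerate (true  ∷ U) (suc i) = suc (enumerate U i)
enumerate (false ∷ U) i       = suc (enumerate U i)

-- The subgraph induced by a nonempty vertex set.
_[_] : (G : Graph) (U : Subset (order G)) → .{{ℕ.NonZero ∣ U ∣}} → Graph
G [ U ] = record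
  { order      = ∣ U ∣
  ; adj        = λ i j → adj (enumerate U i) (enumerate U j)
  ; adj-sym    = λ i j → adj-sym (enumerate U i) (enumerate U j)
  ; adj-irrefl = λ i → adj-irrefl (enumerate U i)
  }
  where open Graph G

-- H is, up to isomorphism, a (not necessarily induced) subgraph of G.
record _⊆_ (H G : Graph) : Set where
  field
    embed     : Vertex H → Vertex G
    injective : Injective _≡_ _≡_ embed
    preserves : ∀ {u v} → Graph._~_ H u v → Graph._~_ G (embed u) (embed v)

record _≅_ (G H : Graph) : Set where
  field
    bijection : Vertex G ↔ Vertex H
    adjacency : ∀ u v → Graph._~_ G u v ⇔
                        Graph._~_ H (Inverse.to bijection u) (Inverse.to bijection v)

module _ (G : Graph) where
  open Graph G using (adj; _~_)

  degree : Vertex G → ℕ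
  degree v = ∣ tabulate (adj v) ∣

  maxDegree : ℕ
  maxDegree = max 0 (List.map degree (allFin (order G)))

  -- Each edge is listed once, smaller endpoint first.
  edges : List (Vertex G × Vertex G)
  edges = filter (λ (u , v) → u Fin.<? v ×-dec T? (adj u v))
                 (cartesianProduct (allFin (order G)) (allFin (order G)))

  record Cycle : Set where
    field
      start    : Vertex G
      rest     : List (Vertex G)
      long     : 2 ≤ length rest
      distinct : UniqueList (start ∷ rest)
      closed   : Linked _~_ (start ∷ rest ∷ʳ start)

  Connected : Rel (Vertex G) 0ℓ
  Connected = Star _~_

  IsComponent : Subset (order G) → Set
  IsComponent U = ∃ λ v → ∀ w → w ∈ U ⇔ Connected v w

averageDegree : Graph → ℚ
averageDegree G@record { order = n } = + (2 ℕ.* length (edges G)) / n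

IsMaximumAverageDegree : Graph → ℚ → Set
IsMaximumAverageDegree G q =
  (∃ λ H → H ⊆ G × averageDegree H ≡ q) × (∀ H → H ⊆ G → averageDegree H ℚ.≤ q)

-- K₁,ᵣ, with centre zero.
star : ℕ → Graph
star r = record
  { order      = suc r
  ; adj        = edge
  ; adj-sym    = edge-sym
  ; adj-irrefl = λ where
      zero    → refl
      (suc _) → refl
  }
  where
  edge : Fin (suc r) → Fin (suc r) → Bool
  edge zero    zero    = false
  edge zero    (suc _) = true
  edge (suc _) zero    = true
  edge (suc _) (suc _) = false

  edge-sym : ∀ u v → edge u v ≡ edge v u
  edge-sym zero    zero    = refl
  edge-sym zero    (suc _) = refl
  edge-sym (suc _) zero    = refl
  edge-sym (suc _) (suc _) = refl

------------------------------------------------------------------------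
-- Graph families

Family : Set₁
Family = Graph → Set

𝓢 : Family
𝓢 G = (U : Subset (order G)) .{{_ : ℕ.NonZero ∣ U ∣}} →
      IsComponent G U → ∃ λ r → (G [ U ]) ≅ star r

𝓕 : Family
𝓕 G = ¬ Cycle G

𝓓 : ℕ → Family
𝓓 d G = maxDegree G ≤ d

𝓜 : ℕ → Family
𝓜 k G = ∃ λ q → IsMaximumAverageDegree G q × q ℚ.≤ + k / 1

------------------------------------------------------------------------
-- List colourings, with the natural numbers as colours

colourClass : (G : Graph) → (Vertex G → ℕ) → ℕ → Subset (order G)
colourClass G φ c = tabulate (λ v → does (φ v ℕ.≟ c))

IsColouring : Family → (G : Graph) → (Vertex G → ℕ) → Set
IsColouring 𝒢 G φ = ∀ c → .{{_ : ℕ.NonZero ∣ colourClass G φ c ∣}} → 𝒢 (G [ colourClass G φ c ])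

-- A vector without repetitions represents a set of exactly n colours.
record ListAssignment (n : ℕ) (G : Graph) : Set where
  field
    list   : Vertex G → Vec ℕ n
    unique : ∀ v → Unique (list v)

Choosable : Family → ℕ → Graph → Set
Choosable 𝒢 n G = (L : ListAssignment n G) → ∃ λ (φ : Vertex G → ℕ) →
  IsColouring 𝒢 G φ × (∀ v → φ v Vec.∈ ListAssignment.list L v)

IsLeast : (ℕ → Set) → ℕ → Set
IsLeast P n = P n × (∀ m → P m → n ≤ m)

-- IsChoiceNumber 𝒢 G n says that n is the 𝒢-choice number of G.
IsChoiceNumber : Family → Graph → ℕ → Set
IsChoiceNumber 𝒢 G = IsLeast (λ n → 0 < n × Choosable 𝒢 n G)

------------------------------------------------------------------------
-- Real numbers, as Cauchy sequences of rationals

record ℝ : Set where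
  field
    seq    : ℕ → ℚ
    cauchy : ∀ ε → 0ℚ ℚ.< ε → ∃ λ N → ∀ m n → N ≤ m → N ≤ n →
             ℚ.∣ seq m ℚ.- seq n ∣ ℚ.≤ ε

open ℝ

infix 4 _≤ℝ_ _≥ℝ_
infixl 7 _·_

_≤ℝ_ : Rel ℝ 0ℓ
x ≤ℝ y = ∀ ε → 0ℚ ℚ.< ε → ∃ λ N → ∀ n → N ≤ n → seq x n ℚ.≤ seq y n ℚ.+ ε

_≥ℝ_ : Rel ℝ 0ℓ
x ≥ℝ y = y ≤ℝ x

fromℕ : ℕ → ℝ
fromℕ n = record
  { seq    = λ _ → + n / 1
  ; cauchy = λ ε 0<ε → 0 , λ _ _ _ _ → begin
      ℚ.∣ + n / 1 ℚ.- + n / 1 ∣ ≡⟨ cong ℚ.∣_∣ (ℚ.+-inverseʳ (+ n / 1)) ⟩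
      0ℚ                        ≤⟨ ℚ.<⇒≤ 0<ε ⟩
      ε                         ∎
  }
  where open ℚ.≤-Reasoning

_·_ : ℝ → ℕ → ℝ
x · zero  = fromℕ 0
x · suc n = record
  { seq    = λ i → seq x i ℚ.* c
  ; cauchy = λ ε 0<ε → let (N , close) = cauchy x (ε ℚ.* 1/c) (scaled-pos ε 0<ε) in
      N , λ i j N≤i N≤j → begin
        ℚ.∣ seq x i ℚ.* c ℚ.- seq x j ℚ.* c ∣
          ≡⟨ cong ℚ.∣_∣ (factor (seq x i) (seq x j)) ⟩
        ℚ.∣ (seq x i ℚ.- seq x j) ℚ.* c ∣
          ≡⟨ ℚ.∣p*q∣≡∣p∣*∣q∣ (seq x i ℚ.- seq x j) c ⟩
        ℚ.∣ seq x i ℚ.- seq x j ∣ ℚ.* ℚ.∣ c ∣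
          ≡⟨ cong (ℚ.∣ seq x i ℚ.- seq x j ∣ ℚ.*_) (ℚ.0≤p⇒∣p∣≡p (ℚ.nonNegative⁻¹ c)) ⟩
        ℚ.∣ seq x i ℚ.- seq x j ∣ ℚ.* c
          ≤⟨ ℚ.*-monoʳ-≤-nonNeg c (close i j N≤i N≤j) ⟩
        ε ℚ.* 1/c ℚ.* c
          ≡⟨ ℚ.*-assoc ε 1/c c ⟩
        ε ℚ.* (1/c ℚ.* c)
          ≡⟨ cong (ε ℚ.*_) (ℚ.*-inverseˡ c) ⟩
        ε ℚ.* 1ℚ
          ≡⟨ ℚ.*-identityʳ ε ⟩
        ε ∎
  }
  where
  open ℚ.≤-Reasoning

  c : ℚ
  c = + suc n / 1

  instance
    c-pos : ℚ.Positive c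
    c-pos = ℚ.normalize-pos (suc n) 1

    c-nonNeg : ℚ.NonNegative c
    c-nonNeg = ℚ.pos⇒nonNeg c

    c-nonZero : ℚ.NonZero c
    c-nonZero = ℚ.pos⇒nonZero c

  1/c : ℚ
  1/c = ℚ.1/ c

  scaled-pos : ∀ ε → 0ℚ ℚ.< ε → 0ℚ ℚ.< ε ℚ.* 1/c
  scaled-pos ε 0<ε = ℚ.positive⁻¹ (ε ℚ.* 1/c)
    {{ℚ.pos*pos⇒pos ε {{ℚ.positive 0<ε}} 1/c {{ℚ.1/pos⇒pos c}}}}

  factor : ∀ p q → p ℚ.* c ℚ.- q ℚ.* c ≡ (p ℚ.- q) ℚ.* c
  factor p q = trans (cong (p ℚ.* c ℚ.+_) (ℚ.neg-distribˡ-* q c))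
                     (sym (ℚ.*-distribʳ-+ c p (ℚ.- q)))

-- G is the complete bipartite graph with a = k (k + 1) − 1 vertices in the small
-- part and very many in the large part.
--
-- Given lists of size k, greedily give any colour that lies in at least k + 1 of the
-- remaining lists of the small part to all vertices concerned. This happens at most
-- k − 1 times, after which Hall's theorem colours the rest of the small part with
-- distinct colours. So fewer than k colours are repeated there, each large-part vertex
-- can avoid them, and every colour class is edgeless or a star with isolated vertices.
--
-- Conversely, split part of the small side into m groups with disjoint lists of size m,
-- and let the large side contain many copies of every transversal of these lists.
-- However the groups are coloured, the copies of one transversal use only colours
-- occurring in (or, if the groups have m + 1 vertices, repeated in) a group. Groups of
-- one vertex, with m = a, yield a monochromatic K₁,d₊₁; groups of m + 1 vertices, with
-- m = k − 1, yield a monochromatic K₂,₃, which has average degree 12/5. Hence the 𝓢-,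
-- 𝓕- and 𝓜₂-choice numbers all equal k, and the second claim needs no case split
-- on the sign of p.

module Submission where

open import Defs
open import Data.Nat.Base using (ℕ; _+_; _*_; _≤_)
open import Data.Product.Base using (∃; _×_)

open import Algebra.Properties.CommutativeSemigroup using (x∙yz≈y∙xz)
open import Data.Bool.Base using (Bool; true; false; if_then_else_; T; _xor_)
import Data.Bool.Properties as Bool
open import Data.Empty using (⊥; ⊥-elim)
open import Data.Fin.Base as Fin
  using (Fin; zero; suc; inject≤; toℕ; combine; remQuot; splitAt; _↑ˡ_; _↑ʳ_; finToFun; funToFin)
open import Data.Fin.Permutation using (transpose)
import Data.Fin.Properties as Fin
open import Data.Fin.Subset as Subset using (Subset; ∣_∣; ⊤)
import Data.Fin.Subset.Properties as Subset
open import Data.Integer.Base as ℤ using (+_; -[1+_])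
import Data.Integer.Properties as ℤ
open import Data.List.Base as List
  using (List; []; _∷_; allFin; cartesianProduct; concatMap; filter; length; lookup)
open import Data.List.Extrema.Nat using (max≤v⁺; xs≤max)
import Data.List.Membership.DecPropositional as DecMembership
open import Data.List.Membership.Propositional using (_∈_; _∉_; find; lose)
open import Data.List.Membership.Propositional.Properties
  using (∈-allFin; ∈-cartesianProduct⁺; ∈-concatMap⁺; ∈-filter⁺; ∈-filter⁻; ∈-lookup; ∈-map⁺; ∈-map⁻; ∈-tabulate⁻)
open import Data.List.Properties
  using (filter-none; filter-notAll; filter-some; length-filter; length-map; length-tabulate)
open import Data.List.Relation.Unary.All as All using (All; []; _∷_)
import Data.List.Relation.Unary.All.Properties as All
open import Data.List.Relation.Unary.AllPairs as AllPairs using ([]; _∷_)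
open import Data.List.Relation.Unary.Any as Any using (here; there; any?)
open import Data.List.Relation.Unary.Any.Properties using (lookup-index)
open import Data.List.Relation.Unary.Linked using ([-]; _∷_)
open import Data.List.Relation.Unary.Unique.Propositional using () renaming (Unique to UniqueList)
import Data.List.Relation.Unary.Unique.Propositional.Properties as Unique
open import Data.Nat.Base as ℕ using (zero; suc; _<_; _^_; z≤n; s≤s)
open import Data.Nat.DivMod using (_mod_; m<n⇒m%n≡m; m%n<n)
open import Data.Nat.ListAction using (sum)
import Data.Nat.Properties as ℕ
open import Data.Product.Base using (∃₂; _,_; proj₁; proj₂)
open import Data.Rational.Base as ℚ using (ℚ; mkℚ; _/_; 0ℚ; 1ℚ)
import Data.Rational.Properties as ℚ
import Data.Rational.Unnormalised.Base as ℚᵘ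
import Data.Rational.Unnormalised.Properties as ℚᵘ
open import Data.Sum.Base as Sum using (_⊎_; inj₁; inj₂; [_,_])
open import Data.Vec.Base as Vec using (Vec; []; _∷_)
import Data.Vec.Membership.Propositional as Vec
import Data.Vec.Membership.Propositional.Properties as Vec
open import Data.Vec.Properties using (lookup∘tabulate; lookup⇒[]=; []=⇒lookup; take++drop≡id)
import Data.Vec.Relation.Unary.Any.Properties as VecAny
open import Data.Vec.Relation.Unary.Unique.Propositional using (Unique)
import Data.Vec.Relation.Unary.Unique.Propositional.Properties as VecUnique
open import Function.Base using (_∘_; const; flip; id)
open import Function.Bundles using (_⇔_; mk⇔; Equivalence; Injection; Inverse)
open import Function.Construct.Identity using (↔-id; ⇔-id)
open import Function.Definitions using (Injective)
open import Function.Properties.Inverse using (↔⇒↣)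
open import Level using (0ℓ)
open import Relation.Binary.Construct.Closure.ReflexiveTransitive using (ε; _◅_)
open import Relation.Binary.Core using (REL)
open import Relation.Binary.Definitions using (Decidable; DecidableEquality; tri<; tri≈; tri>)
open import Relation.Binary.PropositionalEquality hiding ([_])
open import Relation.Nullary.Decidable
  using (Dec; yes; no; ¬?; _×-dec_; dec-false; dec-true; decidable-stable; does; from-no)
open import Relation.Nullary.Negation using (¬_; contradiction)
open import Relation.Unary as Unary using (Pred)

open Graph using (order; Vertex; adj)
open DecMembership ℕ._≟_ using (_∈?_)

-- Counting

module _ {A : Set} where

  lookup-injective : ∀ {xs : List A} → UniqueList xs → Injective _≡_ _≡_ (lookup xs)
  lookup-injective (x∉xs ∷ xs!) {zero}  {zero}  eq = refl
  lookup-injective (x∉xs ∷ xs!) {zero}  {suc j} eq = contradiction eq (All.lookup x∉xs (∈-lookup j))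
  lookup-injective (x∉xs ∷ xs!) {suc i} {zero}  eq = contradiction (sym eq) (All.lookup x∉xs (∈-lookup i))
  lookup-injective (x∉xs ∷ xs!) {suc i} {suc j} eq = cong suc (lookup-injective xs! eq)

  length-mono-⊆ : ∀ {xs ys : List A} → UniqueList xs → (∀ {x} → x ∈ xs → x ∈ ys) → length xs ≤ length ys
  length-mono-⊆ {xs} {ys} xs! xs⊆ys = Fin.injective⇒≤ {f = position} position-injective
    where
    position : Fin (length xs) → Fin (length ys)
    position i = Any.index (xs⊆ys (∈-lookup i))

    position-injective : Injective _≡_ _≡_ position
    position-injective {i} {j} eq = lookup-injective xs!
      (trans (lookup-index (xs⊆ys (∈-lookup i)))
        (trans (cong (lookup ys) eq) (sym (lookup-index (xs⊆ys (∈-lookup j))))))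

  length-filter-∁ : ∀ {P : Pred A 0ℓ} (P? : Unary.Decidable P) xs →
                    length (filter P? xs) + length (filter (¬? ∘ P?) xs) ≡ length xs
  length-filter-∁ P? []       = refl
  length-filter-∁ P? (x ∷ xs) with does (P? x)
  ... | true  = cong suc (length-filter-∁ P? xs)
  ... | false = trans (ℕ.+-suc _ _) (cong suc (length-filter-∁ P? xs))

  sum-map-≥ : ∀ {k} (f : A → ℕ) xs → (∀ {x} → x ∈ xs → k ≤ f x) → length xs * k ≤ sum (List.map f xs)
  sum-map-≥ f []       k≤f = z≤n
  sum-map-≥ f (x ∷ xs) k≤f = ℕ.+-mono-≤ (k≤f (here refl)) (sum-map-≥ f xs (k≤f ∘ there))

  sum-map-≤ : ∀ {k} (f : A → ℕ) xs → (∀ {x} → x ∈ xs → f x ≤ k) → sum (List.map f xs) ≤ length xs * k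
  sum-map-≤ f []       f≤k = z≤n
  sum-map-≤ f (x ∷ xs) f≤k = ℕ.+-mono-≤ (f≤k (here refl)) (sum-map-≤ f xs (f≤k ∘ there))

module _ {A B : Set} {P : REL A B 0ℓ} (P? : Decidable P) where

  -- Both sides count the related pairs. In the induction on `xs`, `row` distributes the row of `x`
  -- over the column counts.
  sum-swap : ∀ xs ys → sum (List.map (λ x → length (filter (P? x) ys)) xs) ≡
                       sum (List.map (λ y → length (filter (flip P? y) xs)) ys)
  sum-swap []       ys = none ys
    where
    none : ∀ ys → 0 ≡ sum (List.map (λ _ → 0) ys)
    none []       = refl
    none (_ ∷ ys) = none ys
  sum-swap (x ∷ xs) ys = trans (cong (length (filter (P? x) ys) ℕ.+_) (sum-swap xs ys)) (row ys)
    where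
    column : B → ℕ
    column y = length (filter (flip P? y) xs)

    row : ∀ ys → length (filter (P? x) ys) + sum (List.map (λ y → length (filter (flip P? y) xs)) ys) ≡
                 sum (List.map (λ y → length (filter (flip P? y) (x ∷ xs))) ys)
    row []       = refl
    row (y ∷ ys) with does (P? x y)
    ... | true  = cong suc (trans (x∙yz≈y∙xz ℕ.+-commutativeSemigroup (length (filter (P? x) ys)) (column y) _)
                                  (cong (column y ℕ.+_) (row ys)))
    ... | false = trans (x∙yz≈y∙xz ℕ.+-commutativeSemigroup (length (filter (P? x) ys)) (column y) _)
                        (cong (column y ℕ.+_) (row ys))

  double-counting : ∀ {k r} xs ys →
                    (∀ {x} → x ∈ xs → k ≤ length (filter (P? x) ys)) →
                    (∀ {y} → y ∈ ys → length (filter (flip P? y) xs) ≤ r) →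
                    length xs * k ≤ length ys * r
  double-counting {k} {r} xs ys k≤ ≤r = begin
    length xs * k                                            ≤⟨ sum-map-≥ _ xs k≤ ⟩
    sum (List.map (λ x → length (filter (P? x) ys)) xs)      ≡⟨ sum-swap xs ys ⟩
    sum (List.map (λ y → length (filter (flip P? y) xs)) ys) ≤⟨ sum-map-≤ _ ys ≤r ⟩
    length ys * r                                            ∎
    where open ℕ.≤-Reasoning

length-allFin : ∀ n → length (allFin n) ≡ n
length-allFin n = length-tabulate id

-- If every fibre had at most `r` elements, double counting the pairs with `f i ≡ j` would give
-- `n ≤ m * r`, since each `i` lies in at least one pair.
many-to-one : ∀ {m n} r → m * r < n → (f : Fin n → Fin m) →
              ∃₂ λ j (e : Fin (suc r) → Fin n) → Injective _≡_ _≡_ e × (∀ i → f (e i) ≡ j)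
many-to-one {m} {n} r mr<n f with Fin.any? (λ j → suc r ℕ.≤? length (filter (λ i → f i Fin.≟ j) (allFin n)))
... | yes (j , r<) = j , e
                   , (λ eq → Fin.inject≤-injective r< r< _ _ (lookup-injective (Unique.filter⁺ _ (Unique.allFin⁺ n)) eq))
                   , λ i → proj₂ (∈-filter⁻ (λ i → f i Fin.≟ j) {xs = allFin n} (∈-lookup (inject≤ i r<)))
  where
  e : Fin (suc r) → Fin n
  e i = lookup (filter (λ i → f i Fin.≟ j) (allFin n)) (inject≤ i r<)
... | no ¬r< = contradiction mr<n (ℕ.≤⇒≯ (begin
    n                       ≡⟨ ℕ.*-identityʳ n ⟨
    n * 1                   ≡⟨ cong (_* 1) (length-allFin n) ⟨
    length (allFin n) * 1   ≤⟨ double-counting (λ i j → f i Fin.≟ j) (allFin n) (allFin m)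
                                 (λ {i} _ → filter-some (f i Fin.≟_) (lose (∈-allFin (f i)) refl))
                                 (λ {j} _ → ℕ.≮⇒≥ (λ r< → ¬r< (j , r<))) ⟩
    length (allFin m) * r   ≡⟨ cong (_* r) (length-allFin m) ⟩
    m * r                   ∎))
  where open ℕ.≤-Reasoning

-- Colouring with few repeated colours

module _ {V : Set} (_≟_ : DecidableEquality V) where

  open DecMembership _≟_ using () renaming (_∈?_ to _∈ᵥ?_)

  update : (V → ℕ) → V → ℕ → V → ℕ
  update φ u c v = if does (v ≟ u) then c else φ v

  -- The lists have at least `k + 1` colours, so this `k` is one less than the list size of the
  -- theorem.
  module ListColouring {k} (L : V → List ℕ) (L! : ∀ v → UniqueList (L v)) (k≤L : ∀ v → suc k ≤ length (L v)) where

    occurrences : ℕ → List V → ℕ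
    occurrences c xs = length (filter (λ v → c ∈? L v) xs)

    -- A system of distinct representatives for the lists of the vertices in `P`. Values outside `P`
    -- are unconstrained, so a partial transversal can still be a total function.
    record IsTransversal (P : V → Set) (φ : V → ℕ) : Set where
      field
        chosen    : ∀ {v} → P v → φ v ∈ L v
        injective : ∀ {u v} → P u → P v → φ u ≡ φ v → u ≡ v
    open IsTransversal

    -- An augmenting-path search: φ₀ leaves x uncovered, and every u in R is the
    -- only uncovered vertex of some transversal using no new colours and
    -- differing from φ₀ only on R.
    module _ {x xs φ₀} (xs! : UniqueList (x ∷ xs)) (φ₀-transversal : IsTransversal (_∈ xs) φ₀)
             (rare : ∀ c → occurrences c (x ∷ xs) ≤ suc k) where

      record Exposes (R : List V) (u : V) : Set where
        field
          φ           : V → ℕ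
          transversal : IsTransversal (λ v → v ∈ x ∷ xs × v ≢ u) φ
          agrees      : ∀ {v} → v ∈ xs → v ∉ R → φ v ≡ φ₀ v
          no-new      : ∀ {v} → v ∈ x ∷ xs → v ≢ u → φ v ∈ List.map φ₀ xs

      -- By `no-new`, the covered vertices use only colours of `φ₀`, so the fresh colour `c` can go
      -- to `u` without a clash.
      finish : ∀ {R u c} → Exposes R u → c ∈ L u → c ∉ List.map φ₀ xs → ∃ (IsTransversal (_∈ x ∷ xs))
      finish {R} {u} {c} e c∈Lu c-new = update φ u c , record { chosen = chosen′ ; injective = injective′ }
        where
        open Exposes e
        chosen′ : ∀ {v} → v ∈ x ∷ xs → update φ u c v ∈ L v
        chosen′ {v} v∈ with v ≟ u
        ... | yes refl = c∈Lu
        ... | no  v≢u  = chosen transversal (v∈ , v≢u)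
        injective′ : ∀ {v w} → v ∈ x ∷ xs → w ∈ x ∷ xs → update φ u c v ≡ update φ u c w → v ≡ w
        injective′ {v} {w} v∈ w∈ eq with v ≟ u | w ≟ u
        ... | yes refl | yes refl = refl
        ... | yes refl | no  w≢u  = contradiction (subst (_∈ _) (sym eq) (no-new w∈ w≢u)) c-new
        ... | no  v≢u  | yes refl = contradiction (subst (_∈ _) eq (no-new v∈ v≢u)) c-new
        ... | no  v≢u  | no  w≢u  = injective transversal (v∈ , v≢u) (w∈ , w≢u) eq

      weaken : ∀ {R u w} → Exposes R u → Exposes (w ∷ R) u
      weaken e = record
        { φ           = φ
        ; transversal = transversal
        ; agrees      = λ v∈ v∉ → agrees v∈ (v∉ ∘ there)
        ; no-new      = no-new
        }
        where open Exposes e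

      -- One alternating step: `u` takes over `φ₀ w` and `w` becomes the uncovered vertex. As
      -- `w ∉ R`, `agrees` gives `φ w ≡ φ₀ w`, so by injectivity no other covered vertex has that
      -- colour.
      extend : ∀ {R u w} → Exposes R u → u ∈ R → w ∈ xs → w ∉ R → φ₀ w ∈ L u → Exposes (w ∷ R) w
      extend {R} {u} {w} e u∈R w∈ w∉R φ₀w∈Lu = record
        { φ           = update φ u (φ₀ w)
        ; transversal = record { chosen = chosen′ ; injective = injective′ }
        ; agrees      = agrees′
        ; no-new      = no-new′
        }
        where
        open Exposes e
        w≢u : w ≢ u
        w≢u refl = w∉R u∈R
        other : ∀ {v} → v ∈ x ∷ xs → v ≢ w → v ≢ u → φ v ≢ φ₀ w
        other v∈ v≢w v≢u eq = v≢w (injective transversal (v∈ , v≢u) (there w∈ , w≢u)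
                                (trans eq (sym (agrees w∈ w∉R))))
        chosen′ : ∀ {v} → v ∈ x ∷ xs × v ≢ w → update φ u (φ₀ w) v ∈ L v
        chosen′ {v} (v∈ , _) with v ≟ u
        ... | yes refl = φ₀w∈Lu
        ... | no  v≢u  = chosen transversal (v∈ , v≢u)
        injective′ : ∀ {v v′} → v ∈ x ∷ xs × v ≢ w → v′ ∈ x ∷ xs × v′ ≢ w →
                     update φ u (φ₀ w) v ≡ update φ u (φ₀ w) v′ → v ≡ v′
        injective′ {v} {v′} (v∈ , v≢w) (v′∈ , v′≢w) eq with v ≟ u | v′ ≟ u
        ... | yes refl | yes refl = refl
        ... | yes refl | no  v′≢u = contradiction (sym eq) (other v′∈ v′≢w v′≢u)
        ... | no  v≢u  | yes refl = contradiction eq (other v∈ v≢w v≢u)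
        ... | no  v≢u  | no  v′≢u = injective transversal (v∈ , v≢u) (v′∈ , v′≢u) eq
        agrees′ : ∀ {v} → v ∈ xs → v ∉ w ∷ R → update φ u (φ₀ w) v ≡ φ₀ v
        agrees′ {v} v∈ v∉ with v ≟ u
        ... | yes refl = contradiction (there u∈R) v∉
        ... | no  v≢u  = agrees v∈ (v∉ ∘ there)
        no-new′ : ∀ {v} → v ∈ x ∷ xs → v ≢ w → update φ u (φ₀ w) v ∈ List.map φ₀ xs
        no-new′ {v} v∈ v≢w with v ≟ u
        ... | yes refl = ∈-map⁺ φ₀ w∈
        ... | no  v≢u  = no-new v∈ v≢u

      -- Such an `R` would violate Hall's condition. All its colours lie in `D`, which is shorter
      -- than `R` because `x` is in `R` but not in `xs`. Each vertex of `R` meets at least `k + 1`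
      -- entries of `D`, each colour at most `k + 1` vertices of `R`, and double counting
      -- contradicts `D<R`.
      closed-impossible : ∀ {R} → UniqueList R → (∀ {u} → u ∈ R → u ∈ x ∷ xs) → x ∈ R →
                          ¬ (∀ {u c} → u ∈ R → c ∈ L u → ∃ λ w → w ∈ xs × w ∈ R × c ≡ φ₀ w)
      closed-impossible {R} R! R⊆ x∈R closed = ℕ.<⇒≱ (ℕ.*-monoˡ-< (suc k) D<R)
        (double-counting (λ u c → c ∈? L u) R D L⊆D few)
        where
        ys = filter (_∈ᵥ? R) xs
        D  = List.map φ₀ ys
        D<R : length D < length R
        D<R = begin-strict
          length D        ≡⟨ length-map φ₀ ys ⟩
          length ys       <⟨ ℕ.n<1+n _ ⟩
          length (x ∷ ys) ≤⟨ length-mono-⊆ (x∉ys ∷ ys!) x∷ys⊆R ⟩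
          length R        ∎
          where
          open ℕ.≤-Reasoning
          ys⊆ : ∀ {y} → y ∈ ys → y ∈ xs × y ∈ R
          ys⊆ = ∈-filter⁻ (_∈ᵥ? R) {xs = xs}
          ys! : UniqueList ys
          ys! = Unique.filter⁺ (_∈ᵥ? R) (AllPairs.tail xs!)
          x∉ys : All (x ≢_) ys
          x∉ys = All.tabulate (λ y∈ → All.lookup (AllPairs.head xs!) (proj₁ (ys⊆ y∈)))
          x∷ys⊆R : ∀ {y} → y ∈ x ∷ ys → y ∈ R
          x∷ys⊆R (here refl) = x∈R
          x∷ys⊆R (there y∈)  = proj₂ (ys⊆ y∈)
        L⊆D : ∀ {u} → u ∈ R → suc k ≤ length (filter (_∈? L u) D)
        L⊆D {u} u∈R = ℕ.≤-trans (k≤L u) (length-mono-⊆ (L! u) (λ {c} c∈Lu →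
          let w , w∈xs , w∈R , c≡φ₀w = closed u∈R c∈Lu in
          ∈-filter⁺ (_∈? L u) (subst (_∈ D) (sym c≡φ₀w) (∈-map⁺ φ₀ (∈-filter⁺ (_∈ᵥ? R) w∈xs w∈R))) c∈Lu))
        few : ∀ {c} → c ∈ D → occurrences c R ≤ suc k
        few {c} _ = ℕ.≤-trans
          (length-mono-⊆ (Unique.filter⁺ (λ v → c ∈? L v) R!) (λ v∈ →
            let v∈R , c∈Lv = ∈-filter⁻ (λ v → c ∈? L v) {xs = R} v∈ in
            ∈-filter⁺ (λ v → c ∈? L v) (R⊆ v∈R) c∈Lv))
          (rare c)

      search : ∀ n R → length (x ∷ xs) ≤ n + length R → UniqueList R → (∀ {u} → u ∈ R → u ∈ x ∷ xs) →
               x ∈ R → (∀ {u} → u ∈ R → Exposes R u) → ∃ (IsTransversal (_∈ x ∷ xs))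
      search n R n≥ R! R⊆ x∈R e
        with any? (λ u → any? (λ c → ¬? (c ∈? List.map φ₀ xs)) (L u)) R
           | any? (λ w → ¬? (w ∈ᵥ? R) ×-dec any? (λ u → φ₀ w ∈? L u) R) xs
      ... | yes free | _ =
        let u , u∈R , free-u       = find free
            c , c∈Lu , c-new = find free-u
        in finish (e u∈R) c∈Lu c-new
      ... | no ¬free | no ¬new = ⊥-elim (closed-impossible R! R⊆ x∈R λ {u} {c} u∈R c∈Lu →
        let c-old = decidable-stable (c ∈? List.map φ₀ xs) (λ c-new → ¬free (lose u∈R (lose c∈Lu c-new)))
            w , w∈xs , c≡φ₀w = ∈-map⁻ φ₀ c-old
            w∈R = decidable-stable (w ∈ᵥ? R) (λ w∉R →
                    ¬new (lose w∈xs (w∉R , lose u∈R (subst (_∈ L u) c≡φ₀w c∈Lu))))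
        in w , w∈xs , w∈R , c≡φ₀w)
      ... | no _ | yes new = go n n≥
        where
        w     = proj₁ (find new)
        w∈xs  = proj₁ (proj₂ (find new))
        w∉R   = proj₁ (proj₂ (proj₂ (find new)))
        via   = find (proj₂ (proj₂ (proj₂ (find new))))
        w∷R! : UniqueList (w ∷ R)
        w∷R! = All.tabulate (λ {v} v∈R w≡v → w∉R (subst (_∈ R) (sym w≡v) v∈R)) ∷ R!
        w∷R⊆ : ∀ {v} → v ∈ w ∷ R → v ∈ x ∷ xs
        w∷R⊆ (here refl) = there w∈xs
        w∷R⊆ (there v∈R) = R⊆ v∈R
        e′ : ∀ {v} → v ∈ w ∷ R → Exposes (w ∷ R) v
        e′ (here refl) = let u , u∈R , φ₀w∈Lu = via in extend (e u∈R) u∈R w∈xs w∉R φ₀w∈Lu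
        e′ (there v∈R) = weaken (e v∈R)
        go : ∀ n → length (x ∷ xs) ≤ n + length R → ∃ (IsTransversal (_∈ x ∷ xs))
        -- Without fuel, `R` is already as long as `x ∷ xs`, which leaves no room for the fresh
        -- vertex `w`.
        go zero    0≥ = contradiction 0≥ (ℕ.<⇒≱ (length-mono-⊆ w∷R! w∷R⊆))
        go (suc n) n≥ = search n (w ∷ R) (subst (length (x ∷ xs) ≤_) (sym (ℕ.+-suc n (length R))) n≥) w∷R! w∷R⊆ (there x∈R) e′

      augment : ∃ (IsTransversal (_∈ x ∷ xs))
      -- Initially `R` consists of `x` alone, exposed by `φ₀` itself.
      augment = search (length (x ∷ xs)) (x ∷ []) (ℕ.m≤m+n _ _) ([] ∷ [])
        (λ { (here refl) → here refl }) (here refl)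
        λ { (here refl) → record
              { φ           = φ₀
              ; transversal = record
                { chosen    = λ (v∈ , v≢x) → chosen φ₀-transversal (tail v∈ v≢x)
                ; injective = λ (u∈ , u≢x) (v∈ , v≢x) → injective φ₀-transversal (tail u∈ u≢x) (tail v∈ v≢x)
                }
              ; agrees      = λ _ _ → refl
              ; no-new      = λ v∈ v≢x → ∈-map⁺ φ₀ (tail v∈ v≢x)
              } }
        where
        tail : ∀ {v} → v ∈ x ∷ xs → v ≢ x → v ∈ xs
        tail (here refl) v≢x = contradiction refl v≢x
        tail (there v∈)  _   = v∈

    -- Hall's theorem, with degrees at least k + 1 on the left and at most k + 1 on the right.
    transversal-exists : ∀ xs → UniqueList xs → (∀ c → occurrences c xs ≤ suc k) → ∃ (IsTransversal (_∈ xs))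
    transversal-exists []       _              _    = (λ _ → 0) , record { chosen = λ () ; injective = λ () }
    transversal-exists (x ∷ xs) xs!@(_ ∷ xs!′) rare =
      augment xs! (proj₂ (transversal-exists xs xs!′ (λ c → ℕ.≤-trans (drop-first c) (rare c)))) rare
      where
      drop-first : ∀ c → occurrences c xs ≤ occurrences c (x ∷ xs)
      drop-first c with does (c ∈? L x)
      ... | true  = ℕ.n≤1+n _
      ... | false = ℕ.≤-refl

    -- Greedily give a colour lying in more than k + 1 lists to all its vertices; there are
    -- at most j such steps, and then a transversal exists.
    few-repetitions : ∀ j xs → UniqueList xs → length xs < suc j * suc (suc k) →
                      ∃₂ λ φ repeated → length repeated ≤ j × (∀ {v} → v ∈ xs → φ v ∈ L v) ×
                        (∀ {u v} → u ∈ xs → v ∈ xs → φ u ≡ φ v → u ≡ v ⊎ φ u ∈ repeated)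
    few-repetitions j xs xs! xs< with any? (λ c → suc (suc k) ℕ.≤? occurrences c xs) (concatMap L xs)
    ... | no ¬frequent =
      let φ , t = transversal-exists xs xs! rare in
      φ , [] , z≤n , chosen t , λ u∈ v∈ eq → inj₁ (injective t u∈ v∈ eq)
      where
      rare : ∀ c → occurrences c xs ≤ suc k
      rare c with c ∈? concatMap L xs
      ... | yes c∈ = ℕ.≮⇒≥ (λ k< → ¬frequent (lose c∈ k<))
      -- The search for a frequent colour runs only through colours of the lists; any other colour
      -- occurs zero times.
      ... | no  c∉ = subst (_≤ suc k)
        (sym (cong length (filter-none (λ v → c ∈? L v) {xs = xs}
          (All.tabulate (λ v∈ c∈ → c∉ (∈-concatMap⁺ L (lose v∈ c∈)))))))
        z≤n
    ... | yes frequent = go j xs<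
      where
      c : ℕ
      c = proj₁ (find frequent)
      k<c : suc k < occurrences c xs
      k<c = proj₂ (proj₂ (find frequent))
      ys : List V
      ys = filter (λ v → ¬? (c ∈? L v)) xs
      go : ∀ j → length xs < suc j * suc (suc k) →
           ∃₂ λ φ repeated → length repeated ≤ j × (∀ {v} → v ∈ xs → φ v ∈ L v) ×
             (∀ {u v} → u ∈ xs → v ∈ xs → φ u ≡ φ v → u ≡ v ⊎ φ u ∈ repeated)
      -- For `j = 0` there are fewer than `k + 2` vertices, too few for `c` to be frequent.
      go zero xs< = contradiction
        (ℕ.<-≤-trans xs< (ℕ.≤-trans (ℕ.≤-reflexive (ℕ.*-identityˡ _)) (ℕ.≤-trans k<c (length-filter _ xs))))
        (ℕ.<-irrefl refl)
      go (suc j) xs<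
        -- At least `k + 2` vertices receive `c`, which pays for lowering `j` by one.
        with φ , repeated , ≤j , φ∈L , repeats ← few-repetitions j ys (Unique.filter⁺ _ xs!)
               (ℕ.+-cancelˡ-< (suc (suc k)) _ _ (ℕ.≤-<-trans
                 (ℕ.≤-trans (ℕ.+-monoˡ-≤ _ k<c) (ℕ.≤-reflexive (length-filter-∁ (λ v → c ∈? L v) xs))) xs<))
        = φ′ , c ∷ repeated , s≤s ≤j , φ′∈L , repeats′
        where
        φ′ : V → ℕ
        φ′ v = if does (c ∈? L v) then c else φ v
        in-ys : ∀ {v} → v ∈ xs → c ∉ L v → v ∈ ys
        in-ys = ∈-filter⁺ (λ v → ¬? (c ∈? L v))
        φ′∈L : ∀ {v} → v ∈ xs → φ′ v ∈ L v
        φ′∈L {v} v∈ with c ∈? L v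
        ... | yes c∈ = c∈
        ... | no  c∉ = φ∈L (in-ys v∈ c∉)
        repeats′ : ∀ {u v} → u ∈ xs → v ∈ xs → φ′ u ≡ φ′ v → u ≡ v ⊎ φ′ u ∈ c ∷ repeated
        repeats′ {u} {v} u∈ v∈ eq with c ∈? L u | c ∈? L v
        ... | yes _   | _      = inj₂ (here refl)
        ... | no  c∉u | yes c∈ = inj₂ (here eq)
        ... | no  c∉u | no c∉v = Sum.map₂ there (repeats (in-ys u∈ c∉u) (in-ys v∈ c∉v) eq)

-- Induced subgraphs

enumerate-∈ : ∀ {n} (U : Subset n) i → enumerate U i Subset.∈ U
enumerate-∈ (true  ∷ U) zero    = Vec.here
enumerate-∈ (true  ∷ U) (suc i) = Vec.there (enumerate-∈ U i)
enumerate-∈ (false ∷ U) i       = Vec.there (enumerate-∈ U i)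

enumerate-injective : ∀ {n} (U : Subset n) → Injective _≡_ _≡_ (enumerate U)
enumerate-injective (true  ∷ U) {zero}  {zero}  eq = refl
enumerate-injective (true  ∷ U) {suc i} {suc j} eq = cong suc (enumerate-injective U (Fin.suc-injective eq))
enumerate-injective (false ∷ U)                 eq = enumerate-injective U (Fin.suc-injective eq)

enumerate-surjective : ∀ {n} (U : Subset n) {v} → v Subset.∈ U → ∃ λ i → enumerate U i ≡ v
enumerate-surjective (true  ∷ U) Vec.here       = zero , refl
enumerate-surjective (true  ∷ U) (Vec.there v∈) =
  let i , eq = enumerate-surjective U v∈ in suc i , cong suc eq
enumerate-surjective (false ∷ U) (Vec.there v∈) =
  let i , eq = enumerate-surjective U v∈ in i , cong suc eq

∈-colourClass⁺ : ∀ G (φ : Vertex G → ℕ) {c v} → φ v ≡ c → v Subset.∈ colourClass G φ c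
∈-colourClass⁺ G φ {c} {v} eq = lookup⇒[]= v _ (trans (lookup∘tabulate _ v) (dec-true (φ v ℕ.≟ c) eq))

∈-colourClass⁻ : ∀ G (φ : Vertex G → ℕ) {c v} → v Subset.∈ colourClass G φ c → φ v ≡ c
∈-colourClass⁻ G φ {c} {v} v∈ = ℕ.≡ᵇ⇒≡ (φ v) c
  (subst T (trans (sym ([]=⇒lookup v∈)) (lookup∘tabulate (λ v → does (φ v ℕ.≟ c)) v)) _)

-- Complete bipartite graphs

-- The parts are the fibres of s. An induced subgraph has the same shape:
-- biclique n s [ U ] is biclique ∣ U ∣ (s ∘ enumerate U) by definition.
biclique : ∀ n .{{_ : ℕ.NonZero n}} → (Fin n → Bool) → Graph
biclique n s = record
  { order      = n
  ; adj        = λ u v → s u xor s v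
  ; adj-sym    = λ u v → Bool.xor-comm (s u) (s v)
  ; adj-irrefl = λ v → Bool.xor-same (s v)
  }

xor⇒≢ : ∀ {x y} → T (x xor y) → x ≢ y
xor⇒≢ {false} t refl = t
xor⇒≢ {true}  t refl = t

≢⇒xor : ∀ {x y} → x ≢ y → T (x xor y)
≢⇒xor {false} {false} x≢y = x≢y refl
≢⇒xor {false} {true}  x≢y = _
≢⇒xor {true}  {false} x≢y = _
≢⇒xor {true}  {true}  x≢y = x≢y refl

-- The biclique is then a star centred at the true vertex, or edgeless if there is none; the class
-- of every colour that is not repeated in the small part has this shape.
AtMostOneTrue : ∀ {n} → (Fin n → Bool) → Set
AtMostOneTrue s = ∀ {u v} → s u ≡ true → s v ≡ true → u ≡ v

-- A copy of the complete bipartite graph `K_{p,q}` in the biclique of `s`, which may have further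
-- vertices.
record Bipartition {n} (s : Fin n → Bool) (p q : ℕ) : Set where
  field
    trues            : Fin p → Fin n
    trues-injective  : Injective _≡_ _≡_ trues
    trues-true       : ∀ i → s (trues i) ≡ true
    falses           : Fin q → Fin n
    falses-injective : Injective _≡_ _≡_ falses
    falses-false     : ∀ i → s (falses i) ≡ false

  trues≢falses : ∀ {i j} → trues i ≢ falses j
  trues≢falses {i} {j} eq with () ← trans (sym (trues-true i)) (trans (cong s eq) (falses-false j))

  crossing : ∀ i j → T (s (trues i) xor s (falses j))
  crossing i j rewrite trues-true i | falses-false j = _

  crossing′ : ∀ i j → T (s (falses j) xor s (trues i))
  crossing′ i j rewrite trues-true i | falses-false j = _

open Bipartition

restrict : ∀ {n} {s : Fin n → Bool} {p q} (U : Subset n) (B : Bipartition s p q) →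
           (∀ i → trues B i Subset.∈ U) → (∀ i → falses B i Subset.∈ U) → Bipartition (s ∘ enumerate U) p q
restrict {n} {s} U B trues∈U falses∈U = record
  { trues            = λ i → proj₁ (index (trues∈U i))
  ; trues-injective  = λ {i} {j} eq → trues-injective B (index-injective (trues∈U i) (trues∈U j) eq)
  ; trues-true       = λ i → trans (cong s (proj₂ (index (trues∈U i)))) (trues-true B i)
  ; falses           = λ i → proj₁ (index (falses∈U i))
  ; falses-injective = λ {i} {j} eq → falses-injective B (index-injective (falses∈U i) (falses∈U j) eq)
  ; falses-false     = λ i → trans (cong s (proj₂ (index (falses∈U i)))) (falses-false B i)
  }
  where
  index : ∀ {v} → v Subset.∈ U → ∃ λ i → enumerate U i ≡ v
  index = enumerate-surjective U

  index-injective : ∀ {u v} (u∈U : u Subset.∈ U) (v∈U : v Subset.∈ U) →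
                    proj₁ (index u∈U) ≡ proj₁ (index v∈U) → u ≡ v
  index-injective u∈U v∈U eq =
    trans (sym (proj₂ (index u∈U))) (trans (cong (enumerate U) eq) (proj₂ (index v∈U)))

-- Star forests

single-vertex : ∀ n .{{_ : ℕ.NonZero n}} (s : Fin n → Bool) → (∀ (u v : Fin n) → u ≡ v) → ∃ λ r → biclique n s ≅ star r
single-vertex 1             s _   = 0 , record
  { bijection = ↔-id _
  ; adjacency = λ { zero zero → mk⇔ (λ t → xor⇒≢ {s zero} t refl) λ () }
  }
single-vertex (suc (suc n)) s all with () ← all zero (suc zero)

-- Swapping `z` with `zero` moves the only true vertex to the centre. Through this bijection `s`
-- becomes the test for the centre (`side`, following the cases of `transpose`), which determines
-- both adjacencies.
centred : ∀ n .{{_ : ℕ.NonZero n}} {s : Fin n → Bool} {z} → AtMostOneTrue s → s z ≡ true → ∃ λ r → biclique n s ≅ star r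
centred (suc r) {s} {z} unique sz = r , record
  { bijection = π
  ; adjacency = λ u v → adjacency _ _ _ _ (side u) (side v)
  }
  where
  π = transpose z zero

  isZero : Fin (suc r) → Bool
  isZero zero    = true
  isZero (suc _) = false

  side : ∀ u → s u ≡ isZero (Inverse.to π u)
  side u with u Fin.≟ z
  ... | yes refl = sz
  ... | no  u≢z  with u Fin.≟ zero
  ...   | no  u≢0  = other u u≢0 u≢z
    where
    other : ∀ u → u ≢ zero → u ≢ z → s u ≡ isZero u
    other zero    u≢0 _   = contradiction refl u≢0
    other (suc u) _   u≢z = Bool.¬-not (λ su → u≢z (unique su sz))
  ...   | yes refl = trans (Bool.¬-not (λ su → u≢z (unique su sz))) (sym (nonzero z (u≢z ∘ sym)))
    where
    nonzero : ∀ w → w ≢ zero → isZero w ≡ false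
    nonzero zero    w≢0 = contradiction refl w≢0
    nonzero (suc w) _   = refl

  adjacency : ∀ a b x y → a ≡ isZero x → b ≡ isZero y → T (a xor b) ⇔ T (adj (star r) x y)
  adjacency a b zero    zero    refl refl = ⇔-id _
  adjacency a b zero    (suc _) refl refl = ⇔-id _
  adjacency a b (suc _) zero    refl refl = ⇔-id _
  adjacency a b (suc _) (suc _) refl refl = ⇔-id _

-- Every edge of a star contains the centre, but the copy has two disjoint edges.
K₂₂⇒¬star : ∀ {n q r} .{{_ : ℕ.NonZero n}} {s : Fin n → Bool} → Bipartition s 2 (2 + q) → ¬ (biclique n s ≅ star r)
K₂₂⇒¬star {r = r} {s = s} B iso = clash (endpoint (crossing B zero zero)) (endpoint (crossing B (suc zero) (suc zero)))
  where
  f = Inverse.to (_≅_.bijection iso)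
  at-centre : ∀ x y → T (adj (star r) x y) → x ≡ zero ⊎ y ≡ zero
  at-centre zero    _    _ = inj₁ refl
  at-centre (suc _) zero _ = inj₂ refl
  endpoint : ∀ {u v} → T (s u xor s v) → f u ≡ zero ⊎ f v ≡ zero
  endpoint e = at-centre _ _ (Equivalence.to (_≅_.adjacency iso _ _) e)
  centre-unique : ∀ {u v} → f u ≡ zero → f v ≡ zero → u ≡ v
  centre-unique fu fv = Injection.injective (↔⇒↣ (_≅_.bijection iso)) (trans fu (sym fv))
  clash : f (trues B zero) ≡ zero ⊎ f (falses B zero) ≡ zero →
          f (trues B (suc zero)) ≡ zero ⊎ f (falses B (suc zero)) ≡ zero → ⊥
  clash (inj₁ p) (inj₁ q) = contradiction (trues-injective B (centre-unique p q)) λ ()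
  clash (inj₁ p) (inj₂ q) = trues≢falses B (centre-unique p q)
  clash (inj₂ p) (inj₁ q) = trues≢falses B (centre-unique q p)
  clash (inj₂ p) (inj₂ q) = contradiction (falses-injective B (centre-unique p q)) λ ()

module _ {n} .{{_ : ℕ.NonZero n}} {s : Fin n → Bool} where

  trivial-component : ∀ (U : Subset n) .{{_ : ℕ.NonZero ∣ U ∣}} v → (∀ {w} → w Subset.∈ U → w ≡ v) →
                      ∃ λ r → (biclique n s [ U ]) ≅ star r
  trivial-component U v all-v = single-vertex ∣ U ∣ (s ∘ enumerate U)
    λ i j → enumerate-injective U (trans (all-v (enumerate-∈ U i)) (sym (all-v (enumerate-∈ U j))))

  all-true⇒𝓢 : (∀ v → s v ≡ true) → 𝓢 (biclique n s)
  all-true⇒𝓢 all U (v , component) = trivial-component U v λ w∈ → isolated (Equivalence.to (component _) w∈)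
    where
    isolated : ∀ {w} → Connected (biclique n s) v w → w ≡ v
    isolated ε       = refl
    isolated (e ◅ _) = contradiction (trans (all _) (sym (all _))) (xor⇒≢ e)

  -- Any induced subgraph containing the true vertex is a star by `centred`. A component without it
  -- is a single vertex, since an edge would join two false vertices.
  at-most-one-true⇒𝓢 : AtMostOneTrue s → 𝓢 (biclique n s)
  at-most-one-true⇒𝓢 unique U (v , component) with Fin.any? (λ i → s (enumerate U i) Bool.≟ true)
  ... | yes (i , si) = centred ∣ U ∣ (λ su sv → enumerate-injective U (unique su sv)) si
  ... | no  no-true  = trivial-component U v λ w∈ → isolated (Equivalence.to (component _) w∈)
    where
    no-true′ : ∀ {w} → Connected (biclique n s) v w → s w ≢ true
    no-true′ path sw = let i , eq = enumerate-surjective U (Equivalence.from (component _) path) in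
      no-true (i , trans (cong s eq) sw)
    isolated : ∀ {w} → Connected (biclique n s) v w → w ≡ v
    isolated ε       = refl
    isolated (e ◅ _) = contradiction
      (trans (Bool.¬-not (no-true′ ε)) (sym (Bool.¬-not (no-true′ (e ◅ ε))))) (xor⇒≢ e)

  -- Both parts are nonempty, so the graph is connected and `⊤` is a component. Since `𝓢` speaks of
  -- `biclique n s [ ⊤ ]`, the copy is first moved there.
  K₂₂⇒¬𝓢 : ∀ {q} → Bipartition s 2 (2 + q) → ¬ 𝓢 (biclique n s)
  K₂₂⇒¬𝓢 B G∈𝓢 = K₂₂⇒¬star {s = s ∘ enumerate ⊤} (restrict ⊤ B (λ _ → Subset.∈⊤) (λ _ → Subset.∈⊤)) (proj₂ (G∈𝓢 ⊤ whole))
    where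
    instance
      nonZero : ℕ.NonZero ∣ ⊤ {n} ∣
      nonZero = subst ℕ.NonZero (sym (Subset.∣⊤∣≡n n)) (ℕ.>-nonZero (ℕ.≤-<-trans z≤n (Fin.toℕ<n (trues B zero))))
    connected : ∀ w → Connected (biclique n s) (trues B zero) w
    connected w with s w in sw
    ... | true  = crossing B zero zero ◅ ≢⇒xor (λ eq → contradiction (trans (sym (falses-false B zero)) (trans eq sw)) λ ()) ◅ ε
    ... | false = ≢⇒xor (λ eq → contradiction (trans (sym (trues-true B zero)) (trans eq sw)) λ ()) ◅ ε
    whole : IsComponent (biclique n s) ⊤
    whole = trues B zero , λ w → mk⇔ (λ _ → connected w) (λ _ → Subset.∈⊤)

-- Forests

≢-≢⇒≡ : ∀ {x y z : Bool} → x ≢ y → y ≢ z → x ≡ z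
≢-≢⇒≡ x≢y y≢z = trans (Bool.¬-not x≢y) (sym (Bool.¬-not (y≢z ∘ sym)))

module _ {n} .{{_ : ℕ.NonZero n}} {s : Fin n → Bool} where

  all-true⇒𝓕 : (∀ v → s v ≡ true) → 𝓕 (biclique n s)
  all-true⇒𝓕 all record { rest = []    ; long = () }
  all-true⇒𝓕 all record { rest = _ ∷ _ ; closed = e ∷ _ } = xor⇒≢ e (trans (all _) (sym (all _)))

  -- Sides alternate along a cycle. This excludes triangles; in a longer cycle `w` or `x` is true,
  -- and then `y` or `z`, respectively, is a second true vertex.
  at-most-one-true⇒𝓕 : AtMostOneTrue s → 𝓕 (biclique n s)
  at-most-one-true⇒𝓕 unique record { rest = [] ; long = () }
  at-most-one-true⇒𝓕 unique record { rest = _ ∷ [] ; long = s≤s () }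
  at-most-one-true⇒𝓕 unique record { start = w ; rest = x ∷ y ∷ [] ; closed = e₁ ∷ e₂ ∷ e₃ ∷ _ } =
    xor⇒≢ {s y} {s w} e₃ (sym (≢-≢⇒≡ {s w} {s x} {s y} (xor⇒≢ e₁) (xor⇒≢ e₂)))
  at-most-one-true⇒𝓕 unique
    record { start = w ; rest = x ∷ y ∷ z ∷ _ ; distinct = (_ ∷ w≢y ∷ _) ∷ (_ ∷ x≢z ∷ _) ∷ _ ; closed = e₁ ∷ e₂ ∷ e₃ ∷ _ }
    with s w Bool.≟ true | s x Bool.≟ true
  ... | yes sw | _      = w≢y (unique sw (trans (sym (≢-≢⇒≡ (xor⇒≢ e₁) (xor⇒≢ e₂))) sw))
  ... | no  _  | yes sx = x≢z (unique sx (trans (sym (≢-≢⇒≡ (xor⇒≢ e₂) (xor⇒≢ e₃))) sx))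
  ... | no ¬sw | no ¬sx = xor⇒≢ e₁ (trans (Bool.¬-not ¬sw) (sym (Bool.¬-not ¬sx)))

  K₂₂⇒¬𝓕 : ∀ {q} → Bipartition s 2 (2 + q) → ¬ 𝓕 (biclique n s)
  K₂₂⇒¬𝓕 B acyclic = acyclic record
    { start    = trues B zero
    ; rest     = falses B zero ∷ trues B (suc zero) ∷ falses B (suc zero) ∷ []
    ; long     = s≤s (s≤s z≤n)
    ; distinct = (trues≢falses B ∷ (λ eq → contradiction (trues-injective B eq) λ ()) ∷ trues≢falses B ∷ [])
               ∷ (trues≢falses B ∘ sym ∷ (λ eq → contradiction (falses-injective B eq) λ ()) ∷ [])
               ∷ (trues≢falses B ∷ [])
               ∷ [] ∷ []
    ; closed   = crossing B zero zero ∷ crossing′ B (suc zero) zero ∷ crossing B (suc zero) (suc zero)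
               ∷ crossing′ B zero (suc zero) ∷ [-]
    }

-- Bounded degree

∣tabulate∣≡0 : ∀ {n} {f : Fin n → Bool} → (∀ i → f i ≡ false) → ∣ Vec.tabulate f ∣ ≡ 0
∣tabulate∣≡0 {zero}  _ = refl
∣tabulate∣≡0 {suc n} {f} f≡false with f zero | f≡false zero
... | false | refl = ∣tabulate∣≡0 (f≡false ∘ suc)

module _ {n} .{{_ : ℕ.NonZero n}} {s : Fin n → Bool} where

  one-sided⇒𝓓 : ∀ d → (∀ u v → s u ≡ s v) → 𝓓 d (biclique n s)
  one-sided⇒𝓓 d same = max≤v⁺ {xs = List.map (degree (biclique n s)) (allFin n)} z≤n (All.map⁺ (All.tabulate λ {v} _ →
    ℕ.≤-trans (ℕ.≤-reflexive (∣tabulate∣≡0 λ u → trans (cong (s v xor_) (same u v)) (Bool.xor-same (s v)))) z≤n))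

  K₁ₑ⇒¬𝓓 : ∀ {d e} → d < e → Bipartition s 1 e → ¬ 𝓓 d (biclique n s)
  K₁ₑ⇒¬𝓓 {d} {e} d<e B small = contradiction d<e (ℕ.≤⇒≯ (begin
    e                  ≤⟨ Fin.injective⇒≤ index-injective ⟩
    degree G v         ≤⟨ All.lookup (xs≤max 0 (List.map (degree G) (allFin n))) (∈-map⁺ (degree G) (∈-allFin v)) ⟩
    maxDegree G        ≤⟨ small ⟩
    d                  ∎))
    where
    open ℕ.≤-Reasoning
    G = biclique n s
    v = trues B zero
    neighbour : ∀ i → falses B i Subset.∈ Vec.tabulate (adj G v)
    neighbour i = lookup⇒[]= (falses B i) _
      (trans (lookup∘tabulate _ (falses B i)) (cong₂ _xor_ (trues-true B zero) (falses-false B i)))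
    index : Fin e → Fin (degree G v)
    index i = proj₁ (enumerate-surjective _ (neighbour i))
    index-injective : Injective _≡_ _≡_ index
    index-injective {i} {j} eq = falses-injective B
      (trans (sym (proj₂ (enumerate-surjective _ (neighbour i))))
        (trans (cong (enumerate _) eq) (proj₂ (enumerate-surjective _ (neighbour j)))))

-- Maximum average degree

/-mono-≤ : ∀ {a b m n} .{{_ : ℕ.NonZero m}} .{{_ : ℕ.NonZero n}} → a * n ≤ b * m → + a / m ℚ.≤ + b / n
/-mono-≤ {a} {b} {suc m} {suc n} an≤bm = ℚ.toℚᵘ-cancel-≤ (begin
  ℚ.toℚᵘ (+ a / suc m)  ≃⟨ ℚ.toℚᵘ-fromℚᵘ (ℚᵘ.mkℚᵘ (+ a) m) ⟩
  ℚᵘ.mkℚᵘ (+ a) m       ≤⟨ ℚᵘ.*≤* (subst₂ ℤ._≤_ (ℤ.pos-* a (suc n)) (ℤ.pos-* b (suc m)) (ℤ.+≤+ an≤bm)) ⟩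
  ℚᵘ.mkℚᵘ (+ b) n       ≃⟨ ℚ.toℚᵘ-fromℚᵘ (ℚᵘ.mkℚᵘ (+ b) n) ⟨
  ℚ.toℚᵘ (+ b / suc n)  ∎)
  where open ℚᵘ.≤-Reasoning

order>0 : ∀ G → 0 < order G
order>0 record { order = n ; order≢0 = n≢0 } = ℕ.>-nonZero⁻¹ n {{n≢0}}

module _ (G : Graph) where
  open Graph G using (_~_)

  edges! : UniqueList (edges G)
  edges! = Unique.filter⁺ _ (Unique.cartesianProduct⁺ (Unique.allFin⁺ _) (Unique.allFin⁺ _))

  ∈-edges⁻ : ∀ {u v} → (u , v) ∈ edges G → u ~ v
  ∈-edges⁻ e = proj₂ (proj₂ (∈-filter⁻ _ {xs = cartesianProduct (allFin _) (allFin _)} e))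

  ∈-edges⁺ : ∀ {u v} → u ~ v → (u , v) ∈ edges G ⊎ (v , u) ∈ edges G
  ∈-edges⁺ {u} {v} e with Fin.<-cmp u v
  ... | tri< u<v _    _   = inj₁ (∈-filter⁺ _ (∈-cartesianProduct⁺ (∈-allFin u) (∈-allFin v)) (u<v , e))
  ... | tri≈ _   refl _   = contradiction e (subst (¬_ ∘ T) (sym (Graph.adj-irrefl G u)) id)
  ... | tri> _   _    v<u = inj₂ (∈-filter⁺ _ (∈-cartesianProduct⁺ (∈-allFin v) (∈-allFin u))
                              (v<u , subst T (Graph.adj-sym G u v) e))

  edgeless : (∀ {u v} → ¬ u ~ v) → length (edges G) ≡ 0
  edgeless none = ℕ.n≤0⇒n≡0 (length-mono-⊆ {ys = []} edges! λ e → contradiction (∈-edges⁻ e) none)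

  -- Every edge joins the centre to a leaf.
  edges<order : ∀ {s : Vertex G → Bool} → AtMostOneTrue s → (∀ {u v} → u ~ v → s u ≢ s v) →
                length (edges G) < order G
  edges<order {s} unique proper with Fin.any? (λ v → s v Bool.≟ true)
  ... | no none = subst (_< order G)
    (sym (edgeless λ e → proper e (trans (Bool.¬-not (λ su → none (_ , su))) (sym (Bool.¬-not (λ sv → none (_ , sv)))))))
    (order>0 G)
  ... | yes (z , sz) = begin-strict
    length (edges G)                    ≤⟨ length-mono-⊆ edges! edge∈ ⟩
    length (List.map spoke leaves)      ≡⟨ length-map spoke leaves ⟩
    -- Strict, because the centre `z` is not a leaf.
    length leaves                       <⟨ filter-notAll (λ v → s v Bool.≟ false) (allFin (order G))
                                             (lose (∈-allFin z) λ sz′ → contradiction (trans (sym sz) sz′) λ ()) ⟩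
    length (allFin (order G))           ≡⟨ length-allFin (order G) ⟩
    order G                             ∎
    where
    open ℕ.≤-Reasoning
    leaves : List (Vertex G)
    leaves = filter (λ v → s v Bool.≟ false) (allFin (order G))
    -- `edges` lists the smaller endpoint first, so the orientation depends on how `v` compares with
    -- `z`.
    spoke : Vertex G → Vertex G × Vertex G
    spoke v = if does (v Fin.<? z) then (v , z) else (z , v)
    leaf : ∀ {v} → s v ≡ false → v ∈ leaves
    leaf sv = ∈-filter⁺ (λ v → s v Bool.≟ false) (∈-allFin _) sv
    spoke-< : ∀ {v} → v Fin.< z → spoke v ≡ (v , z)
    spoke-< {v} v<z rewrite dec-true (v Fin.<? z) v<z = refl
    spoke-> : ∀ {v} → z Fin.< v → spoke v ≡ (z , v)
    spoke-> {v} z<v rewrite dec-false (v Fin.<? z) (ℕ.<-asym z<v) = refl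
    edge∈ : ∀ {e} → e ∈ edges G → e ∈ List.map spoke leaves
    edge∈ {u , v} e∈ with _ , u<v , e ← ∈-filter⁻ _ {xs = cartesianProduct (allFin _) (allFin _)} e∈
                        with s u in su | s v in sv
    ... | true  | true  = contradiction (trans su (sym sv)) (proper e)
    ... | false | false = contradiction (trans su (sym sv)) (proper e)
    ... | true  | false with refl ← unique su sz = subst (_∈ _) (spoke-> u<v) (∈-map⁺ spoke (leaf sv))
    ... | false | true  with refl ← unique sv sz = subst (_∈ _) (spoke-< u<v) (∈-map⁺ spoke (leaf su))

⊆-refl : ∀ {G} → G ⊆ G
⊆-refl = record { embed = id ; injective = id ; preserves = id }

-- The hypothesis compares the densities `|E| / |V|` by cross-multiplication. It makes `G` its own
-- densest subgraph, which supplies the exact maximum that `𝓜` asks for.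
maximum-average-degree : ∀ G → (∀ H → H ⊆ G → length (edges H) * order G ≤ length (edges G) * order H) →
                         IsMaximumAverageDegree G (averageDegree G)
maximum-average-degree G densest = (G , ⊆-refl , refl) , λ H H⊆G →
  /-mono-≤ {2 * length (edges H)} {2 * length (edges G)} {order H} {order G}
    {{ℕ.>-nonZero (order>0 H)}} {{ℕ.>-nonZero (order>0 G)}} (begin
    2 * length (edges H) * order G    ≡⟨ ℕ.*-assoc 2 (length (edges H)) _ ⟩
    2 * (length (edges H) * order G)  ≤⟨ ℕ.*-monoʳ-≤ 2 (densest H H⊆G) ⟩
    2 * (length (edges G) * order H)  ≡⟨ ℕ.*-assoc 2 (length (edges G)) _ ⟨
    2 * length (edges G) * order H    ∎)
  where open ℕ.≤-Reasoning

averageDegree≤2 : ∀ G → length (edges G) ≤ order G → averageDegree G ℚ.≤ + 2 / 1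
averageDegree≤2 G sparse = /-mono-≤ {2 * length (edges G)} {2} {order G} {1} {{ℕ.>-nonZero (order>0 G)}}
  (subst (_≤ 2 * order G) (sym (ℕ.*-identityʳ _)) (ℕ.*-monoʳ-≤ 2 sparse))

edgeless⇒𝓜 : ∀ G → (∀ {u v} → ¬ Graph._~_ G u v) → 𝓜 2 G
edgeless⇒𝓜 G none = averageDegree G
  , maximum-average-degree G (λ H H⊆G → subst (λ e → e * order G ≤ length (edges G) * order H)
      (sym (edgeless H (none ∘ _⊆_.preserves H⊆G))) z≤n)
  , averageDegree≤2 G (subst (_≤ order G) (sym (edgeless G none)) z≤n)

-- A subgraph on `n` vertices has density at most `1 - 1/n`, which grows with `n`, and `G` reaches
-- this value for its own order. `densest` clears denominators and adds `order H` to both sides.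
tree⇒𝓜 : ∀ G → order G ≤ suc (length (edges G)) → (∀ H → H ⊆ G → length (edges H) < order H) → 𝓜 2 G
tree⇒𝓜 G spanning sparse = averageDegree G
  , maximum-average-degree G densest
  , averageDegree≤2 G (ℕ.<⇒≤ (sparse G ⊆-refl))
  where
  densest : ∀ H → H ⊆ G → length (edges H) * order G ≤ length (edges G) * order H
  densest H H⊆G = ℕ.+-cancelʳ-≤ (order H) _ _ (begin
    length (edges H) * order G + order H    ≤⟨ ℕ.+-monoʳ-≤ _ (Fin.injective⇒≤ (_⊆_.injective H⊆G)) ⟩
    length (edges H) * order G + order G    ≡⟨ ℕ.+-comm _ (order G) ⟩
    suc (length (edges H)) * order G        ≤⟨ ℕ.*-monoˡ-≤ (order G) (sparse H H⊆G) ⟩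
    order H * order G                       ≤⟨ ℕ.*-monoʳ-≤ (order H) spanning ⟩
    order H * suc (length (edges G))        ≡⟨ ℕ.*-comm (order H) _ ⟩
    order H + length (edges G) * order H    ≡⟨ ℕ.+-comm (order H) _ ⟩
    length (edges G) * order H + order H    ∎)
    where open ℕ.≤-Reasoning

module _ {n} .{{_ : ℕ.NonZero n}} {s : Fin n → Bool} where

  one-sided⇒𝓜 : (∀ u v → s u ≡ s v) → 𝓜 2 (biclique n s)
  one-sided⇒𝓜 same = edgeless⇒𝓜 (biclique n s) (λ {u} {v} e → xor⇒≢ {s u} e (same u v))

  at-most-one-true⇒𝓜 : AtMostOneTrue s → 𝓜 2 (biclique n s)
  at-most-one-true⇒𝓜 unique = by-centre (Fin.any? (λ v → s v Bool.≟ true))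
    where
    G = biclique n s
    sparse : ∀ H → H ⊆ G → length (edges H) < order H
    sparse H H⊆G = edges<order H
      (λ su sv → _⊆_.injective H⊆G (unique su sv)) (λ e → xor⇒≢ (_⊆_.preserves H⊆G e))
    -- The false endpoint of an edge. Every vertex except `z` arises in this way, so there are at
    -- least `n - 1` edges.
    other : Fin n × Fin n → Fin n
    other (u , v) = if s u then v else u
    spanning : ∀ {z} → s z ≡ true → n ≤ suc (length (edges G))
    spanning {z} sz = begin
      n                                         ≡⟨ length-allFin n ⟨
      length (allFin n)                         ≤⟨ length-mono-⊆ (Unique.allFin⁺ n) (λ {v} _ → reached v) ⟩
      suc (length (List.map other (edges G)))   ≡⟨ cong suc (length-map other (edges G)) ⟩
      suc (length (edges G))                    ∎
      where
      open ℕ.≤-Reasoning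
      reached : ∀ v → v ∈ z ∷ List.map other (edges G)
      reached v with s v in sv
      ... | true  = here (unique sv sz)
      ... | false with ∈-edges⁺ G {z} {v} (≢⇒xor λ eq → contradiction (trans (sym sz) (trans eq sv)) λ ())
      ...   | inj₁ e = there (subst (_∈ _) (cong (if_then v else z) sz) (∈-map⁺ other e))
      ...   | inj₂ e = there (subst (_∈ _) (cong (if_then z else v) sv) (∈-map⁺ other e))
    by-centre : Dec (∃ λ v → s v ≡ true) → 𝓜 2 G
    by-centre (yes (_ , sz)) = tree⇒𝓜 G (spanning sz) sparse
    -- Without a true vertex there are no edges, so `spanning` would fail for `n ≥ 2`.
    by-centre (no none)      = one-sided⇒𝓜 λ u v →
      trans (Bool.¬-not (λ su → none (u , su))) (sym (Bool.¬-not (λ sv → none (v , sv))))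

  -- `K_{2,2}` has average degree exactly 2 and would not suffice. For `K_{2,3}`, the comparison of
  -- 12/5 with 2 is decided by evaluation.
  K₂₃⇒¬𝓜 : Bipartition s 2 3 → ¬ 𝓜 2 (biclique n s)
  K₂₃⇒¬𝓜 B (q , (_ , maximal) , q≤2) =
    from-no (averageDegree K₂₃ ℚ.≤? + 2 / 1) (ℚ.≤-trans (maximal K₂₃ K₂₃⊆) q≤2)
    where
    side : Fin 5 → Bool
    side zero          = true
    side (suc zero)    = true
    side (suc (suc _)) = false
    K₂₃ = biclique 5 side
    f : Fin 5 → Fin n
    f zero          = trues B zero
    f (suc zero)    = trues B (suc zero)
    f (suc (suc i)) = falses B i
    f-side : ∀ i → s (f i) ≡ side i
    f-side zero          = trues-true B zero
    f-side (suc zero)    = trues-true B (suc zero)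
    f-side (suc (suc i)) = falses-false B i
    f-injective : Injective _≡_ _≡_ f
    f-injective {zero}        {zero}        eq = refl
    f-injective {zero}        {suc zero}    eq = contradiction (trues-injective B eq) λ ()
    f-injective {zero}        {suc (suc j)} eq = contradiction eq (trues≢falses B)
    f-injective {suc zero}    {zero}        eq = contradiction (trues-injective B eq) λ ()
    f-injective {suc zero}    {suc zero}    eq = refl
    f-injective {suc zero}    {suc (suc j)} eq = contradiction eq (trues≢falses B)
    f-injective {suc (suc i)} {zero}        eq = contradiction (sym eq) (trues≢falses B)
    f-injective {suc (suc i)} {suc zero}    eq = contradiction (sym eq) (trues≢falses B)
    f-injective {suc (suc i)} {suc (suc j)} eq = cong (λ i → suc (suc i)) (falses-injective B eq)
    K₂₃⊆ : K₂₃ ⊆ biclique n s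
    K₂₃⊆ = record
      { embed     = f
      ; injective = f-injective
      ; preserves = λ {u} {v} → subst T (sym (cong₂ _xor_ (f-side u) (f-side v)))
      }

-- Lists of colours

module _ {n} (xs : Vec ℕ n) (xs! : Unique xs) where

  colours : List ℕ
  colours = List.tabulate (Vec.lookup xs)

  colours! : UniqueList colours
  colours! = Unique.tabulate⁺ (VecUnique.lookup-injective xs! _ _)

  ∈-colours⁻ : ∀ {c} → c ∈ colours → c Vec.∈ xs
  ∈-colours⁻ c∈ with i , refl ← ∈-tabulate⁻ c∈ = Vec.∈-lookup i xs

  avoid : ∀ ys → length ys < n → ∃ λ c → c Vec.∈ xs × c ∉ ys
  avoid ys ys<n with any? (λ c → ¬? (c ∈? ys)) colours
  ... | yes new = let c , c∈ , c∉ = find new in c , ∈-colours⁻ c∈ , c∉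
  ... | no ¬new = contradiction ys<n (ℕ.≤⇒≯ (subst (_≤ length ys) (length-tabulate (Vec.lookup xs))
    (length-mono-⊆ colours! λ {c} c∈ → decidable-stable (c ∈? ys) λ c∉ → ¬new (lose c∈ c∉))))

-- Choice numbers

choosable-mono : ∀ 𝒢 {G m n} → m ≤ n → Choosable 𝒢 m G → Choosable 𝒢 n G
choosable-mono 𝒢 {m = m} m≤n choosable L with o , refl ← ℕ.m≤n⇒∃[o]m+o≡n m≤n =
  let φ , colouring , φ∈ = choosable record
        { list   = λ v → Vec.take m (list v)
        ; unique = λ v → VecUnique.take⁺ m (unique v)
        }
  in φ , colouring , λ v → subst (φ v Vec.∈_) (take++drop≡id m (list v)) (Vec.∈-++⁺ˡ (φ∈ v))
  where open ListAssignment L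

-- Choosability is monotone in the list size, so failure at `n` rules out every smaller size as
-- well.
isChoiceNumber : ∀ 𝒢 {G n} → Choosable 𝒢 (suc n) G → ¬ Choosable 𝒢 n G → IsChoiceNumber 𝒢 G (suc n)
isChoiceNumber 𝒢 choosable ¬choosable =
  (s≤s z≤n , choosable) , λ m (_ , m-choosable) → ℕ.≰⇒> λ m≤n → ¬choosable (choosable-mono 𝒢 m≤n m-choosable)

-- A left inverse of `inject≤`. Reduction modulo `m` gives surplus vertices a group or transversal
-- too, so every vertex has a list.
retract : ∀ m {n} .{{_ : ℕ.NonZero m}} → Fin n → Fin m
retract m i = toℕ i mod m

retract-inject≤ : ∀ {m n} .{{_ : ℕ.NonZero m}} (i : Fin m) (m≤n : m ≤ n) → retract m (inject≤ i m≤n) ≡ i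
retract-inject≤ {m} i m≤n = Fin.toℕ-injective (begin
  toℕ (toℕ (inject≤ i m≤n) mod m)   ≡⟨ Fin.toℕ-fromℕ< (m%n<n (toℕ (inject≤ i m≤n)) m) ⟩
  toℕ (inject≤ i m≤n) ℕ.% m         ≡⟨ cong (ℕ._% m) (Fin.toℕ-inject≤ i m≤n) ⟩
  toℕ i ℕ.% m                       ≡⟨ m<n⇒m%n≡m (Fin.toℕ<n i) ⟩
  toℕ i                             ∎)
  where open ≡-Reasoning

-- List colourings of complete bipartite graphs

module _ (a b : ℕ) .{{_ : ℕ.NonZero (a + b)}} where

  -- `true` marks the small part, so `AtMostOneTrue` for a colour class says that its colour occurs
  -- at most once there.
  side : Fin (a + b) → Bool
  side v = [ const true , const false ] (splitAt a v)

  K : Graph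
  K = biclique (a + b) side

  combineColourings : (Fin a → ℕ) → (Fin b → ℕ) → Fin (a + b) → ℕ
  combineColourings φ ψ v = [ φ , ψ ] (splitAt a v)

  module _ (φ : Fin a → ℕ) (ψ : Fin b → ℕ) where

    class : ℕ → Subset (a + b)
    class = colourClass K (combineColourings φ ψ)

    class-at : ∀ {c} i → combineColourings φ ψ (enumerate (class c) i) ≡ c
    class-at {c} i = ∈-colourClass⁻ K (combineColourings φ ψ) (enumerate-∈ (class c) i)

    class-side : ∀ {c} → Fin ∣ class c ∣ → Bool
    class-side {c} i = side (enumerate (class c) i)

    class-all-true : ∀ {c} → (∀ y → ψ y ≢ c) → ∀ i → class-side {c} i ≡ true
    class-all-true {c} ψ≢c i with splitAt a (enumerate (class c) i) | class-at {c} i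
    ... | inj₁ _ | _  = refl
    ... | inj₂ y | eq = contradiction eq (ψ≢c y)

    class-all-false : ∀ {c} → (∀ x → φ x ≢ c) → ∀ i → class-side {c} i ≡ false
    class-all-false {c} φ≢c i with splitAt a (enumerate (class c) i) | class-at {c} i
    ... | inj₁ x | eq = contradiction eq (φ≢c x)
    ... | inj₂ _ | _  = refl

    class-at-most-one-true : ∀ {c} → (∀ {x y} → φ x ≡ c → φ y ≡ c → x ≡ y) → AtMostOneTrue (class-side {c})
    class-at-most-one-true {c} once {i} {j} si sj
      with splitAt a (enumerate (class c) i) in eqi | class-at {c} i
         | splitAt a (enumerate (class c) j) in eqj | class-at {c} j
    ... | inj₁ x | φx | inj₁ y | φy = enumerate-injective (class c) (begin
        enumerate (class c) i   ≡⟨ Fin.splitAt⁻¹-↑ˡ eqi ⟨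
        x ↑ˡ b                  ≡⟨ cong (_↑ˡ b) (once φx φy) ⟩
        y ↑ˡ b                  ≡⟨ Fin.splitAt⁻¹-↑ˡ eqj ⟩
        enumerate (class c) j   ∎)
      where open ≡-Reasoning
    class-at-most-one-true {c} once {i} {j} () sj | inj₂ _ | _ | _ | _
    class-at-most-one-true {c} once {i} {j} si () | inj₁ _ | _ | inj₂ _ | _

  -- Colour the small part with at most k repeated colours, and let the large part avoid them.
  few-repetitions⇒choosable : ∀ (𝒢 : Family) →
    (∀ {n} .{{_ : ℕ.NonZero n}} {s : Fin n → Bool} → AtMostOneTrue s ⊎ (∀ v → s v ≡ true) → 𝒢 (biclique n s)) →
    ∀ {k} → a < suc k * suc (suc k) → Choosable 𝒢 (suc k) K
  few-repetitions⇒choosable 𝒢 𝒢-sparse {k} a< L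
    with φ , repeated , few , φ∈ , repeats ← ListColouring.few-repetitions Fin._≟_
           (λ x → colours (ListAssignment.list L (x ↑ˡ b)) (ListAssignment.unique L (x ↑ˡ b)))
           (λ x → colours! (ListAssignment.list L (x ↑ˡ b)) (ListAssignment.unique L (x ↑ˡ b)))
           (λ x → ℕ.≤-reflexive (sym (length-tabulate (Vec.lookup (ListAssignment.list L (x ↑ˡ b))))))
           k (allFin a) (Unique.allFin⁺ a) (subst (_< suc k * suc (suc k)) (sym (length-allFin a)) a<)
    = combineColourings φ ψ , colouring , member
    where
    open ListAssignment L
    avoiding : ∀ y → ∃ λ c → c Vec.∈ list (a ↑ʳ y) × c ∉ repeated
    avoiding y = avoid (list (a ↑ʳ y)) (unique (a ↑ʳ y)) repeated (s≤s few)
    ψ : Fin b → ℕ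
    ψ y = proj₁ (avoiding y)
    colouring : IsColouring 𝒢 K (combineColourings φ ψ)
    colouring c = 𝒢-sparse (sparse (c ∈? repeated))
      where
      sparse : Dec (c ∈ repeated) → AtMostOneTrue (class-side φ ψ {c}) ⊎ (∀ i → class-side φ ψ {c} i ≡ true)
      -- The large part avoids a repeated colour, so its class lies in the small part; any other
      -- colour occurs at most once there.
      sparse (yes c∈) = inj₂ (class-all-true φ ψ λ { y refl → proj₂ (proj₂ (avoiding y)) c∈ })
      sparse (no  c∉) = inj₁ (class-at-most-one-true φ ψ once)
        where
        once : ∀ {x y} → φ x ≡ c → φ y ≡ c → x ≡ y
        once {x} {y} φx φy with repeats (∈-allFin x) (∈-allFin y) (trans φx (sym φy))
        ... | inj₁ x≡y = x≡y
        ... | inj₂ φx∈ = contradiction (subst (_∈ repeated) φx φx∈) c∉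
    member : ∀ v → combineColourings φ ψ v Vec.∈ list v
    member v with splitAt a v in eq
    ... | inj₁ x = subst (λ v → φ x Vec.∈ list v) (Fin.splitAt⁻¹-↑ˡ eq)
                     (∈-colours⁻ (list (x ↑ˡ b)) (unique (x ↑ˡ b)) (φ∈ (∈-allFin x)))
    ... | inj₂ y = subst (λ v → ψ y Vec.∈ list v) (Fin.splitAt⁻¹-↑ʳ eq) (proj₁ (proj₂ (avoiding y)))

  -- The small part uses at most `a` colours, and lists of `a + 1` colours let the large part avoid
  -- them all. No colour meets both parts, so every class is edgeless.
  𝓓-choosable : ∀ d → Choosable (𝓓 d) (suc a) K
  𝓓-choosable d L = combineColourings φ ψ , colouring , member
    where
    open ListAssignment L
    φ : Fin a → ℕ
    φ x = Vec.head (list (x ↑ˡ b))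
    avoiding : ∀ y → ∃ λ c → c Vec.∈ list (a ↑ʳ y) × c ∉ List.map φ (allFin a)
    avoiding y = avoid (list (a ↑ʳ y)) (unique (a ↑ʳ y)) (List.map φ (allFin a))
      (s≤s (ℕ.≤-reflexive (trans (length-map φ (allFin a)) (length-allFin a))))
    ψ : Fin b → ℕ
    ψ y = proj₁ (avoiding y)
    colouring : IsColouring (𝓓 d) K (combineColourings φ ψ)
    colouring c = one-sided⇒𝓓 d (same (Fin.any? (λ x → φ x ℕ.≟ c)))
      where
      same : Dec (∃ λ x → φ x ≡ c) → ∀ i j → class-side φ ψ {c} i ≡ class-side φ ψ {c} j
      same (yes (x , refl)) i j = trans (all-true i) (sym (all-true j))
        where
        all-true = class-all-true φ ψ λ y ψy≡φx → proj₂ (proj₂ (avoiding y))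
          (subst (_∈ List.map φ (allFin a)) (sym ψy≡φx) (∈-map⁺ φ (∈-allFin x)))
      same (no φ≢c) i j = trans (all-false i) (sym (all-false j))
        where
        all-false = class-all-false φ ψ λ x φx≡c → φ≢c (x , φx≡c)
    member : ∀ v → combineColourings φ ψ v Vec.∈ list v
    member v with splitAt a v in eq
    ... | inj₁ x = subst (λ v → φ x Vec.∈ list v) (Fin.splitAt⁻¹-↑ˡ eq) (head∈ (list (x ↑ˡ b)))
      where
      head∈ : ∀ {n} (xs : Vec ℕ (suc n)) → Vec.head xs Vec.∈ xs
      head∈ (x ∷ xs) = Vec.∈-lookup zero (x ∷ xs)
    ... | inj₂ y = subst (λ v → ψ y Vec.∈ list v) (Fin.splitAt⁻¹-↑ʳ eq) (proj₁ (proj₂ (avoiding y)))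

  -- The small part is split into m groups with disjoint lists, each group large
  -- enough to repeat a colour q + 1 times; the large part contains every
  -- transversal of these lists, often enough that r + 1 copies get the same colour.
  module Transversals {m q r} .{{_ : ℕ.NonZero m}}
    (groups≤a : m * suc (m * q) ≤ a) (transversals≤b : m ^ m * suc (m * r) ≤ b) where

    instance
      groups≢0 : ℕ.NonZero (m * suc (m * q))
      groups≢0 = ℕ.m*n≢0 m (suc (m * q))

      transversals≢0 : ℕ.NonZero (m ^ m * suc (m * r))
      transversals≢0 = ℕ.m*n≢0 (m ^ m) (suc (m * r)) {{ℕ.m^n≢0 m m}}

    -- The colours form an `m` by `m` grid. Row `g` is the common list of group `g`, and a list in
    -- the large part takes one colour from each row.
    colour : Fin m → Fin m → ℕ
    colour g i = toℕ (combine g i)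

    colour-injective : ∀ {g h i j} → colour g i ≡ colour h j → g ≡ h × i ≡ j
    colour-injective eq = Fin.combine-injective _ _ _ _ (Fin.toℕ-injective eq)

    group : Fin a → Fin m
    group x = proj₁ (remQuot (suc (m * q)) (retract (m * suc (m * q)) x))

    inGroup : Fin m → Fin (suc (m * q)) → Fin a
    inGroup g i = inject≤ (combine g i) groups≤a

    group-inGroup : ∀ g i → group (inGroup g i) ≡ g
    group-inGroup g i = cong proj₁ (trans (cong (remQuot (suc (m * q))) (retract-inject≤ (combine g i) groups≤a))
                                          (Fin.remQuot-combine g i))

    inGroup-injective : ∀ g → Injective _≡_ _≡_ (inGroup g)
    inGroup-injective g {i} {j} eq = Fin.combine-injectiveʳ g i g j (Fin.inject≤-injective groups≤a groups≤a _ _ eq)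

    -- A transversal selects a column for every row and is coded by a number below `m ^ m`; the
    -- remainder from `remQuot` numbers its copies.
    choice : Fin b → Fin m → Fin m
    choice y = finToFun (proj₁ (remQuot (suc (m * r)) (retract (m ^ m * suc (m * r)) y)))

    choosing : (Fin m → Fin m) → Fin (suc (m * r)) → Fin b
    choosing f i = inject≤ (combine (funToFin f) i) transversals≤b

    choosing-injective : ∀ f → Injective _≡_ _≡_ (choosing f)
    choosing-injective f {i} {j} eq = Fin.combine-injectiveʳ (funToFin f) i (funToFin f) j
      (Fin.inject≤-injective transversals≤b transversals≤b _ _ eq)

    choice-choosing : ∀ f i g → choice (choosing f i) g ≡ f g
    choice-choosing f i g = trans
      (cong (λ x → finToFun (proj₁ x) g)
        (trans (cong (remQuot (suc (m * r))) (retract-inject≤ (combine (funToFin f) i) transversals≤b))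
               (Fin.remQuot-combine (funToFin f) i)))
      (Fin.finToFun-funToFin f g)

    listˡ : Fin a → Vec ℕ m
    listˡ x = Vec.tabulate (colour (group x))

    listʳ : Fin b → Vec ℕ m
    listʳ y = Vec.tabulate (λ g → colour g (choice y g))

    lists : ListAssignment m K
    lists = record
      { list   = λ v → [ listˡ , listʳ ] (splitAt a v)
      ; unique = λ v → unique (splitAt a v)
      }
      where
      unique : ∀ v → Unique ([ listˡ , listʳ ] v)
      unique (inj₁ x) = VecUnique.tabulate⁺ (λ eq → proj₂ (colour-injective eq))
      unique (inj₂ y) = VecUnique.tabulate⁺ (λ eq → proj₁ (colour-injective eq))

    open ListAssignment lists using (list)

    -- Each group has `m * q + 1` vertices and `m` colours, so some colour, in column `popular g`,
    -- occurs `q + 1` times. Each of the `m * r + 1` copies of the transversal `popular` uses the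
    -- popular colour of one of the `m` groups, so `r + 1` of them agree on a group `g₀`.
    monochromatic : (φ : Fin (a + b) → ℕ) → (∀ v → φ v Vec.∈ list v) →
      ∃ λ c → ∃ λ (B : Bipartition side (suc q) (suc r)) →
        (∀ i → φ (Bipartition.trues B i) ≡ c) × (∀ i → φ (Bipartition.falses B i) ≡ c)
    monochromatic φ φ∈ = colour g₀ (popular g₀)
      , record
        { trues            = λ i → inGroup g₀ (repeat g₀ i) ↑ˡ b
        ; trues-injective  = λ eq → repeat-injective g₀ (inGroup-injective g₀ (Fin.↑ˡ-injective b _ _ eq))
        ; trues-true       = λ i → cong [ const true , const false ] (Fin.splitAt-↑ˡ a _ b)
        ; falses           = λ i → a ↑ʳ choosing popular (copy i)
        ; falses-injective = λ eq → copy-injective (choosing-injective popular (Fin.↑ʳ-injective a _ _ eq))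
        ; falses-false     = λ i → cong [ const true , const false ] (Fin.splitAt-↑ʳ a b _)
        }
      , (λ i → trans (picked-colour g₀ (repeat g₀ i)) (cong (colour g₀) (repeat-popular g₀ i)))
      , (λ i → trans (used-colour (copy i)) (cong (λ g → colour g (popular g)) (copy-used i)))
      where
      inList : ∀ x → φ (x ↑ˡ b) Vec.∈ listˡ x
      inList x = subst (λ v → φ (x ↑ˡ b) Vec.∈ [ listˡ , listʳ ] v) (Fin.splitAt-↑ˡ a x b) (φ∈ (x ↑ˡ b))

      inListʳ : ∀ y → φ (a ↑ʳ y) Vec.∈ listʳ y
      inListʳ y = subst (λ v → φ (a ↑ʳ y) Vec.∈ [ listˡ , listʳ ] v) (Fin.splitAt-↑ʳ a b y) (φ∈ (a ↑ʳ y))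

      picked : ∀ g i → ∃ λ j → φ (inGroup g i ↑ˡ b) ≡ colour (group (inGroup g i)) j
      picked g i = VecAny.tabulate⁻ (inList (inGroup g i))

      picked-colour : ∀ g i → φ (inGroup g i ↑ˡ b) ≡ colour g (proj₁ (picked g i))
      picked-colour g i = trans (proj₂ (picked g i)) (cong (λ h → colour h (proj₁ (picked g i))) (group-inGroup g i))

      repetition : ∀ g → _
      repetition g = many-to-one {m} q (ℕ.n<1+n (m * q)) (λ i → proj₁ (picked g i))

      popular : Fin m → Fin m
      popular g = proj₁ (repetition g)

      repeat : Fin m → Fin (suc q) → Fin (suc (m * q))
      repeat g = proj₁ (proj₂ (repetition g))

      repeat-injective : ∀ g → Injective _≡_ _≡_ (repeat g)
      repeat-injective g = proj₁ (proj₂ (proj₂ (repetition g)))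

      repeat-popular : ∀ g i → proj₁ (picked g (repeat g i)) ≡ popular g
      repeat-popular g = proj₂ (proj₂ (proj₂ (repetition g)))

      used : ∀ i → ∃ λ g → φ (a ↑ʳ choosing popular i) ≡ colour g (choice (choosing popular i) g)
      used i = VecAny.tabulate⁻ (inListʳ (choosing popular i))

      used-colour : ∀ i → φ (a ↑ʳ choosing popular i) ≡ colour (proj₁ (used i)) (popular (proj₁ (used i)))
      used-colour i = trans (proj₂ (used i)) (cong (colour (proj₁ (used i))) (choice-choosing popular i (proj₁ (used i))))

      copies = many-to-one {m} r (ℕ.n<1+n (m * r)) (λ i → proj₁ (used i))

      g₀ : Fin m
      g₀ = proj₁ copies

      copy : Fin (suc r) → Fin (suc (m * r))
      copy = proj₁ (proj₂ copies)

      copy-injective : Injective _≡_ _≡_ copy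
      copy-injective = proj₁ (proj₂ (proj₂ copies))

      copy-used : ∀ i → proj₁ (used (copy i)) ≡ g₀
      copy-used = proj₂ (proj₂ (proj₂ copies))

    ¬choosable : ∀ (𝒢 : Family) →
      (∀ {n} .{{_ : ℕ.NonZero n}} {s : Fin n → Bool} → Bipartition s (suc q) (suc r) → ¬ 𝒢 (biclique n s)) →
      ¬ Choosable 𝒢 m K
    ¬choosable 𝒢 ¬𝒢 choosable =
      let φ , colouring , φ∈ = choosable lists
          c , B , trues-c , falses-c = monochromatic φ φ∈
          B′ = restrict (colourClass K φ c) B (∈-colourClass⁺ K φ ∘ trues-c) (∈-colourClass⁺ K φ ∘ falses-c)
          nonempty = Fin.nonZeroIndex (Bipartition.trues B′ zero)
      in ¬𝒢 {{nonempty}} B′ (colouring c {{nonempty}})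

-- The extremal graph

extremal : ∀ k d → 2 ≤ k → ∃ λ G →
  IsChoiceNumber 𝓢 G k × IsChoiceNumber 𝓕 G k × IsChoiceNumber (𝓜 2) G k × IsChoiceNumber (𝓓 d) G (k * (k + 1))
extremal (suc j@(suc _)) d (s≤s (s≤s _)) = K a b
  , isChoiceNumber 𝓢 (few-repetitions⇒choosable a b 𝓢 [ at-most-one-true⇒𝓢 , all-true⇒𝓢 ] a<) (Pairs.¬choosable 𝓢 K₂₂⇒¬𝓢)
  , isChoiceNumber 𝓕 (few-repetitions⇒choosable a b 𝓕 [ at-most-one-true⇒𝓕 , all-true⇒𝓕 ] a<) (Pairs.¬choosable 𝓕 K₂₂⇒¬𝓕)
  , isChoiceNumber (𝓜 2)
      (few-repetitions⇒choosable a b (𝓜 2)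
        [ at-most-one-true⇒𝓜 , (λ all → one-sided⇒𝓜 λ u v → trans (all u) (sym (all v))) ] a<)
      (Pairs.¬choosable (𝓜 2) K₂₃⇒¬𝓜)
  , isChoiceNumber (𝓓 d) (𝓓-choosable a b d) (Singletons.¬choosable (𝓓 d) (K₁ₑ⇒¬𝓓 (ℕ.n<1+n d)))
  where
  k a b : ℕ
  k = suc j
  -- This is `k * (k + 1) - 1`, written so that `suc a` computes to `k * (k + 1)`.
  a = j + 1 + j * (k + 1)
  -- One summand for each of the two families of transversals below.
  b = j ^ j * suc (j * 2) + a ^ a * suc (a * d)

  a< : a < k * suc k
  a< = ℕ.≤-reflexive (cong (k *_) (ℕ.+-comm k 1))

  -- Lists of size `k - 1` and as many groups of `k` vertices force a `K_{2,3}`, which serves `𝓢`,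
  -- `𝓕` and `𝓜 2` alike.
  module Pairs = Transversals a b {j} {1} {2}
    (ℕ.≤-trans (ℕ.*-monoʳ-≤ j (ℕ.≤-reflexive (trans (cong suc (ℕ.*-identityʳ j)) (ℕ.+-comm 1 j))))
               (ℕ.≤-trans (ℕ.*-monoʳ-≤ j (ℕ.n≤1+n (j + 1))) (ℕ.m≤n+m (j * (k + 1)) (j + 1))))
    (ℕ.m≤m+n _ _)

  -- Lists of size `a`, with every small-part vertex a group of its own, force a `K_{1,d+1}`.
  module Singletons = Transversals a b {a} {0} {d}
    (ℕ.≤-reflexive (trans (cong (λ n → a * suc n) (ℕ.*-zeroʳ a)) (ℕ.*-identityʳ a)))
    (ℕ.m≤n+m _ _)

-- Real multiples of choice numbers

toℚᵘ-/1 : ∀ n → ℚ.toℚᵘ (+ n / 1) ℚᵘ.≃ ℚᵘ.mkℚᵘ (+ n) 0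
toℚᵘ-/1 n = ℚ.toℚᵘ-fromℚᵘ (ℚᵘ.mkℚᵘ (+ n) 0)

-- The denominator is at least 1, so the absolute value of the numerator is already a bound; adding
-- 2 makes it admissible as `k`.
≤-numerator : ∀ q → q ℚ.≤ + (2 + ℤ.∣ ℚ.ℚ.numerator q ∣) / 1
≤-numerator q = ℚ.toℚᵘ-cancel-≤ (ℚᵘ.≤-trans (bound q) (ℚᵘ.≤-reflexive (ℚᵘ.≃-sym (toℚᵘ-/1 (2 + ℤ.∣ ℚ.ℚ.numerator q ∣)))))
  where
  bound : ∀ q → ℚ.toℚᵘ q ℚᵘ.≤ ℚᵘ.mkℚᵘ (+ (2 + ℤ.∣ ℚ.ℚ.numerator q ∣)) 0
  bound (mkℚ (+ n) d _)    = ℚᵘ.*≤* (subst₂ ℤ._≤_ (ℤ.pos-* n 1) (ℤ.pos-* (2 + n) (suc d))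
    (ℤ.+≤+ (ℕ.*-mono-≤ (ℕ.m≤n+m n 2) (s≤s z≤n))))
  bound (mkℚ -[1+ n ] d _) = ℚᵘ.*≤* ℤ.-≤+

/1-homo-* : ∀ m n → (+ m / 1) ℚ.* (+ n / 1) ≡ + (m * n) / 1
/1-homo-* m n = ℚ.toℚᵘ-injective (begin
  ℚ.toℚᵘ ((+ m / 1) ℚ.* (+ n / 1))              ≈⟨ ℚ.toℚᵘ-homo-* (+ m / 1) (+ n / 1) ⟩
  ℚ.toℚᵘ (+ m / 1) ℚᵘ.* ℚ.toℚᵘ (+ n / 1)    ≈⟨ ℚᵘ.*-cong (toℚᵘ-/1 m) (toℚᵘ-/1 n) ⟩
  ℚᵘ.mkℚᵘ (+ m) 0 ℚᵘ.* ℚᵘ.mkℚᵘ (+ n) 0      ≡⟨ cong (λ i → ℚᵘ.mkℚᵘ i 0) (ℤ.pos-* m n) ⟨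
  ℚᵘ.mkℚᵘ (+ (m * n)) 0                     ≈⟨ toℚᵘ-/1 (m * n) ⟨
  ℚ.toℚᵘ (+ (m * n) / 1)                    ∎)
  where open ℚᵘ.≃-Reasoning

p≤p+δ : ∀ p {δ} → 0ℚ ℚ.< δ → p ℚ.≤ p ℚ.+ δ
p≤p+δ p {δ} 0<δ = ℚ.≤-trans (ℚ.≤-reflexive (sym (ℚ.+-identityʳ p))) (ℚ.+-monoʳ-≤ p (ℚ.<⇒≤ 0<δ))

≤ℝ-refl : ∀ x → x ≤ℝ x
≤ℝ-refl x δ 0<δ = 0 , λ n _ → p≤p+δ (ℝ.seq x n) 0<δ

p≤∣p∣ : ∀ p → p ℚ.≤ ℚ.∣ p ∣
p≤∣p∣ (mkℚ (+ n) d _)    = ℚ.≤-refl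
p≤∣p∣ (mkℚ -[1+ n ] d _) = ℚ.*≤* ℤ.-≤+

-- The Cauchy condition for 1 keeps a tail within 1 of its first term, hence below the rational `q`.
eventually-bounded : ∀ p → ∃ λ k → 2 ≤ k × ∃ λ N → ∀ n → N ≤ n → ℝ.seq p n ℚ.≤ + k / 1
eventually-bounded p with N , close ← ℝ.cauchy p 1ℚ (ℚ.positive⁻¹ 1ℚ) =
  2 + ℤ.∣ ℚ.ℚ.numerator q ∣ , s≤s (s≤s z≤n) , N , λ n N≤n → ℚ.≤-trans (≤q n N≤n) (≤-numerator q)
  where
  q : ℚ
  q = 1ℚ ℚ.+ ℝ.seq p N
  ≤q : ∀ n → N ≤ n → ℝ.seq p n ℚ.≤ q
  ≤q n N≤n = begin
    x                    ≡⟨ ℚ.+-identityʳ x ⟨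
    x ℚ.+ 0ℚ             ≡⟨ cong (x ℚ.+_) (ℚ.+-inverseˡ y) ⟨
    x ℚ.+ (ℚ.- y ℚ.+ y)  ≡⟨ ℚ.+-assoc x (ℚ.- y) y ⟨
    x ℚ.- y ℚ.+ y        ≤⟨ ℚ.+-monoˡ-≤ y (ℚ.≤-trans (p≤∣p∣ (x ℚ.- y)) (close n N N≤n ℕ.≤-refl)) ⟩
    1ℚ ℚ.+ y             ∎
    where
    open ℚ.≤-Reasoning
    x = ℝ.seq p n
    y = ℝ.seq p N

-- Only the upper bound `p ≤ k` enters, through `p · k ≤ k * k ≤ k * (k + 1)`, so the sign of `p` is
-- irrelevant. The case split on `k` follows the definition of `_·_`.
bounded-multiple : ∀ p k {N} → (∀ n → N ≤ n → ℝ.seq p n ℚ.≤ + k / 1) → p · k ≤ℝ fromℕ (k * (k + 1))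
bounded-multiple p zero        _ = ≤ℝ-refl (fromℕ 0)
bounded-multiple p k@(suc k-1) {N} p≤k δ 0<δ = N , λ n N≤n → begin
  ℝ.seq p n ℚ.* (+ k / 1)             ≤⟨ ℚ.*-monoʳ-≤-nonNeg (+ k / 1) {{ℚ.normalize-nonNeg k 1}} (p≤k n N≤n) ⟩
  (+ k / 1) ℚ.* (+ k / 1)               ≡⟨ /1-homo-* k k ⟩
  + (k * k) / 1                       ≤⟨ /-mono-≤ {k * k} {k * (k + 1)} (ℕ.*-monoˡ-≤ 1 (ℕ.*-monoʳ-≤ k (ℕ.m≤m+n k 1))) ⟩
  + (k * (k + 1)) / 1                 ≤⟨ p≤p+δ _ 0<δ ⟩
  + (k * (k + 1)) / 1 ℚ.+ δ           ∎
  where open ℚ.≤-Reasoning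

theorem2p3 : ((k d : ℕ) → 2 ≤ k →
    ∃ λ G → (∃ λ s → IsChoiceNumber 𝓢 G s × s ≤ k)
    × IsChoiceNumber (𝓓 d) G (k * (k + 1)))
    ×
    ((p : ℝ) →
    ∃ λ G → ∃ λ c → ∃ λ s → ∃ λ f → ∃ λ m →
    IsChoiceNumber (𝓓 0) G c
    × IsChoiceNumber 𝓢 G s
    × IsChoiceNumber 𝓕 G f
    × IsChoiceNumber (𝓜 2) G m
    × fromℕ c ≥ℝ p · s
    × p · s ≥ℝ p · f
    × p · f ≥ℝ p · m)
theorem2p3 =
    (λ k d 2≤k → let G , 𝓢-number , _ , _ , 𝓓-number = extremal k d 2≤k in
      G , (k , 𝓢-number , ℕ.≤-refl) , 𝓓-number)
  -- An eventual upper bound of `p` serves as `k`, with `d = 0` for the usual choice number.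
  , λ p → let k , 2≤k , _ , p≤k = eventually-bounded p
              G , 𝓢-number , 𝓕-number , 𝓜-number , 𝓓-number = extremal k 0 2≤k in
      G , k * (k + 1) , k , k , k , 𝓓-number , 𝓢-number , 𝓕-number , 𝓜-number
      , bounded-multiple p k p≤k , ≤ℝ-refl (p · k) , ≤ℝ-refl (p · k)
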